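{- Let $N$ be an odd perfect number, let $q$ be a prime and let $\alpha\ge 1$ be an integer such that $q^{\alpha}\,\|\, N$. Then $$\frac{\sigma(N/q^{\alpha})}{q^{\alpha}}>5.$$
   Context: For a positive integer $n$, $\sigma(n)$ denotes the sum of the positive divisors of $n$. A positive integer $N$ is perfect if $\sigma(N)=2N$. The notation $q^{\alpha}\,\|\,N$ means that $q^{\alpha}\mid N$ but $q^{\alpha+1}\nmid N$. -}

module Defs where

open import Data.List.Base using (filter; map; upTo)
open import Data.Nat.Base using (ℕ; suc; _*_; _^_; _>_)
open import Data.Nat.Divisibility using (_∣_; _∤_; _∣?_)
open import Data.Nat.ListAction using (sum)
open import Data.Product.Base using (_×_)
open import Relation.Binary.PropositionalEquality.Core using (_≡_)

-- The candidates range over 1, …, n, so no positive divisor is missed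
-- when n > 0, and 0 is never counted.
σ : ℕ → ℕ
σ n = sum (filter (_∣? n) (map suc (upTo n)))

Perfect : ℕ → Set
Perfect n = n > 0 × σ n ≡ 2 * n

Odd : ℕ → Set
Odd n = 2 ∤ n

-- A single ternary operator: q ^ α ∥ n depends on q and α separately,
-- not only on the value of the power.
infix 4 _^_∥_

_^_∥_ : ℕ → ℕ → ℕ → Set
q ^ α ∥ n = q ^ α ∣ n × q ^ suc α ∤ n

{-# OPTIONS --safe #-}

-- Write N = qᵅ n and geo x k = 1 + x + … + xᵏ⁻¹. Since qᵅ is prime to σ(qᵅ) = geo q (α + 1), it divides σ(n),
-- so σ(n) = m qᵅ and 2n = m geo q (α + 1); the cases m = 0, …, 5 have to be excluded, and m = 0, 4 are immediate.
-- Suppose m is 1 or a prime. If rᵉ ∥ n and geo r (e + 1) is a power of q, it is odd, so e ≥ 1 is even,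
-- and lifting the exponent in r | q^(α+1) − 1 shows that rᵉ divides (m M)² whenever α + 1 | 2M.
-- For prime m exactly one prime power ρᵉ ∥ n escapes: there m | geo ρ (e + 1), and lifting the exponent again
-- gives e + 1 = m and geo ρ m = m qᵞ. Writing n = ρᵐ⁻¹ A, we get σ(A) = q^β with γ + β = α, and q^β ≤ 2A is bounded
-- by a quadratic polynomial in α. On the other hand ρᵐ⁻¹ | q^(α+1) − 1 forces γ to be small compared
-- with β, which contradicts the exponential growth of q^β.
module Submission where

open import Defs
open import Data.Empty using (⊥)
open import Data.Integer.Base as ℤ using (+_; +<+)
import Data.Integer.Properties as ℤ
open import Data.List.Base using (filter; map; upTo; _∷_; []; _∷ʳ_; _++_)
open import Data.List.Properties using (upTo-∷ʳ; filter-++; map-++)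
open import Data.Nat.Base
open import Data.Nat.Coprimality using (Coprime; coprime-divisor)
open import Data.Nat.Divisibility
open import Data.Nat.DivMod
open import Data.Nat.GCD using (gcd; module Bézout; gcd[m,n]∣m; gcd[m,n]∣n; gcd-GCD)
open import Data.Nat.Induction using (<-rec)
open import Data.Nat.ListAction using (sum)
open import Data.Nat.ListAction.Properties using (sum-++)
open import Data.Nat.Primality
open import Data.Nat.Properties
open import Data.Nat.Tactic.RingSolver using (solve-∀)
open import Data.Product.Base using (∃-syntax; _×_; _,_; proj₁; proj₂)
open import Data.Rational.Base as ℚ using ()
import Data.Rational.Properties as ℚ
open import Data.Rational.Unnormalised.Base using (mkℚᵘ; *<*)
import Data.Rational.Unnormalised.Properties as ℚᵘ
open import Data.Sum.Base using (_⊎_; inj₁; inj₂; [_,_]′)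
open import Function.Base using (_∘_; id)
open import Relation.Binary.PropositionalEquality
open import Relation.Nullary using (¬_; Dec; yes; no; contradiction)
open import Relation.Nullary.Decidable using (from-yes; from-no)

private
  variable
    a b c d e k l m n p q r x z : ℕ
    P Q : Set

-- Primes, prime powers and divisibility.

prime≥2 : Prime p → 2 ≤ p
prime≥2 p-prime = nonTrivial⇒n>1 _ {{prime⇒nonTrivial p-prime}}

prime∣prime : Prime p → Prime q → p ∣ q → p ≡ q
prime∣prime p-prime q-prime p∣q with prime⇒irreducible q-prime p∣q
... | inj₁ refl = contradiction p-prime ¬prime[1]
... | inj₂ p≡q  = p≡q

prime∤1 : Prime p → p ∤ 1
prime∤1 p-prime p∣1 = ¬prime[1] (subst Prime (∣1⇒≡1 p∣1) p-prime)

prime∤* : Prime p → p ∤ m → p ∤ n → p ∤ m * n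
prime∤* {m = m} {n = n} p-prime p∤m p∤n p∣mn with euclidsLemma m n p-prime p∣mn
... | inj₁ p∣m = p∤m p∣m
... | inj₂ p∣n = p∤n p∣n

prime∣^ : Prime p → ∀ k → p ∣ x ^ k → p ∣ x
prime∣^ p-prime zero p∣1 = contradiction p∣1 (prime∤1 p-prime)
prime∣^ {x = x} p-prime (suc k) p∣ with euclidsLemma x (x ^ k) p-prime p∣
... | inj₁ p∣x = p∣x
... | inj₂ p∣xᵏ = prime∣^ p-prime k p∣xᵏ

∤⇒coprime : Prime p → p ∤ n → Coprime n p
∤⇒coprime p-prime p∤n (d∣n , d∣p) with prime⇒irreducible p-prime d∣p
... | inj₁ d≡1 = d≡1
... | inj₂ refl = contradiction d∣n p∤n

∣^*-cancel : Prime p → p ∤ d → ∀ e → d ∣ p ^ e * n → d ∣ n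
∣^*-cancel {n = n} p-prime p∤d zero d∣ = subst (_ ∣_) (*-identityˡ n) d∣
∣^*-cancel {p} {d} {n} p-prime p∤d (suc e) d∣ = ∣^*-cancel p-prime p∤d e
  (coprime-divisor (∤⇒coprime p-prime p∤d) (subst (d ∣_) (*-assoc p (p ^ e) n) d∣))

^∣*-cancel : Prime p → p ∤ m → ∀ e → p ^ e ∣ m * n → p ^ e ∣ n
^∣*-cancel p-prime p∤m zero _ = 1∣ _
^∣*-cancel {p} {m} {n} p-prime p∤m (suc e) pᵉ∣mn
  with euclidsLemma m n p-prime (∣-trans (m∣m*n (p ^ e)) pᵉ∣mn)
... | inj₁ p∣m = contradiction p∣m p∤m
... | inj₂ (divides k refl) = subst (p * p ^ e ∣_) (*-comm p k) (*-monoʳ-∣ p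
  (^∣*-cancel p-prime p∤m e (*-cancelˡ-∣ p {{prime⇒nonZero p-prime}}
    (subst (p * p ^ e ∣_) (rearrange m k p) pᵉ∣mn))))
  where
  rearrange : ∀ m k p → m * (k * p) ≡ p * (m * k)
  rearrange = solve-∀

∣prime^ : Prime q → ∀ a → d ∣ q ^ a → ∃[ b ] b ≤ a × d ≡ q ^ b
∣prime^ q-prime zero d∣1 = 0 , z≤n , ∣1⇒≡1 d∣1
∣prime^ {q} {d} q-prime (suc a) d∣ with q ∣? d
... | no q∤d = let b , b≤a , d≡ = ∣prime^ q-prime a (coprime-divisor (∤⇒coprime q-prime q∤d) d∣)
               in b , m≤n⇒m≤1+n b≤a , d≡
... | yes (divides k refl) =
  let instance q≢0 = prime⇒nonZero q-prime
      b , b≤a , k≡ = ∣prime^ q-prime a (*-cancelˡ-∣ q (subst (_∣ q * q ^ a) (*-comm k q) d∣))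
  in suc b , s≤s b≤a , trans (cong (_* q) k≡) (*-comm (q ^ b) q)

^-cancel-≤ : 1 < q → q ^ a ≤ q ^ b → a ≤ b
^-cancel-≤ {q} {a} {b} 1<q le with a ≤? b
... | yes a≤b = a≤b
... | no a≰b = contradiction le (<⇒≱ (^-monoʳ-< q 1<q (≰⇒> a≰b)))

prime-split : Prime p → ∀ n → n > 0 → ∃[ e ] ∃[ k ] n ≡ p ^ e * k × p ∤ k
prime-split {p} p-prime = <-rec _ split
  where
  split : ∀ n → (∀ {k} → k < n → k > 0 → ∃[ e ] ∃[ l ] k ≡ p ^ e * l × p ∤ l) →
          n > 0 → ∃[ e ] ∃[ l ] n ≡ p ^ e * l × p ∤ l
  split n rec n>0 with p ∣? n
  ... | no p∤n = 0 , n , sym (*-identityˡ n) , p∤n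
  ... | yes p∣n@(divides k n≡kp) =
    let instance n≢0 = >-nonZero n>0
        e , l , k≡ , p∤l = rec (quotient-< p∣n {{prime⇒nonTrivial p-prime}})
                               (>-nonZero⁻¹ k {{quotient≢0 p∣n}})
    in suc e , l , trans n≡kp (trans (cong (_* p) k≡) (rearrange (p ^ e) l p)) , p∤l
    where
    rearrange : ∀ a l p → a * l * p ≡ p * a * l
    rearrange = solve-∀

primeDivisor : ∀ n → 1 < n → ∃[ p ] Prime p × p ∣ n
primeDivisor = <-rec _ step
  where
  step : ∀ n → (∀ {k} → k < n → 1 < k → ∃[ p ] Prime p × p ∣ k) → 1 < n → ∃[ p ] Prime p × p ∣ n
  step n rec 1<n with prime? n
  ... | yes n-prime = n , n-prime , ∣-refl
  ... | no ¬prime with ¬prime⇒composite {{n>1⇒nonTrivial 1<n}} ¬prime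
  ... | composite {d} d<n d∣n =
    let p , p-prime , p∣d = rec d<n (nonTrivial⇒n>1 d)
    in p , p-prime , ∣-trans p∣d d∣n

prime-power-factor : ∀ n → 1 < n → ∃[ p ] ∃[ e ] ∃[ k ] Prime p × n ≡ p ^ suc e * k × p ∤ k × 0 < k × k < n
prime-power-factor n 1<n with primeDivisor n 1<n
... | p , p-prime , p∣n with prime-split p-prime n (<-trans z<s 1<n)
... | zero , k , refl , p∤k = contradiction (subst (p ∣_) (*-identityˡ k) p∣n) p∤k
... | suc e , k , n≡ , p∤k = p , e , k , p-prime , n≡ , p∤k , 0<k , k<n
  where
  instance
    p≢0 : NonZero p
    p≢0 = prime⇒nonZero p-prime
  0<k : 0 < k
  0<k = n≢0⇒n>0 λ { refl → p∤k (p ∣0) }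
  k<n : k < n
  k<n = begin-strict
    k ≡⟨ *-identityˡ k ⟨
    1 * k <⟨ *-monoˡ-< k {{>-nonZero 0<k}} (prime≥2 p-prime) ⟩
    p * k ≤⟨ *-monoˡ-≤ k (m≤m*n p (p ^ e) {{m^n≢0 p e}}) ⟩
    p ^ suc e * k ≡⟨ n≡ ⟨
    n ∎
    where open ≤-Reasoning

-- Serves the inductions that strip off one prime power: an exact power in the remaining factor is
-- carried back to the whole number. The primes differ because p ∤ k.
exact-power-* : Prime p → Prime r → p ∤ k → k ≡ r ^ suc e * m → r ∤ m →
  p ^ d * k ≡ r ^ suc e * (p ^ d * m) × r ∤ p ^ d * m
exact-power-* {p} {r} {k} {e} {m} {d} p-prime r-prime p∤k refl r∤m =
  swap (p ^ d) (r ^ suc e) m , prime∤* r-prime (λ r∣pᵈ → r∤p (prime∣^ r-prime d r∣pᵈ)) r∤m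
  where
  swap : ∀ a b c → a * (b * c) ≡ b * (a * c)
  swap = solve-∀
  r∤p : r ∤ p
  r∤p r∣p with prime∣prime r-prime p-prime r∣p
  ... | refl = p∤k (∣-trans (m∣m*n (r ^ e)) (m∣m*n m))

-- Strong induction splits one full prime power off a. The remaining factor k divides b by induction
-- and is prime to p, so it still divides b after the power of p has been cancelled.
prime-powers∣⇒∣ : ∀ a → a > 0 →
  (∀ {p} e k → Prime p → a ≡ p ^ suc e * k → p ∤ k → p ^ suc e ∣ b) → a ∣ b
prime-powers∣⇒∣ {b} = <-rec _ step
  where
  step : ∀ a →
    (∀ {a′} → a′ < a → a′ > 0 →
      (∀ {p} e k → Prime p → a′ ≡ p ^ suc e * k → p ∤ k → p ^ suc e ∣ b) → a′ ∣ b) →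
    a > 0 → (∀ {p} e k → Prime p → a ≡ p ^ suc e * k → p ∤ k → p ^ suc e ∣ b) → a ∣ b
  step (suc zero) _ _ _ = 1∣ b
  step a@(suc (suc _)) rec _ local with prime-power-factor a (s≤s (s≤s z≤n))
  ... | p , e , k , p-prime , a≡ , p∤k , 0<k , k<a
    with local e k p-prime a≡ p∤k
       | rec k<a 0<k (λ f l r-prime k≡ r∤ →
           let split , r∤′ = exact-power-* {e = f} {d = suc e} p-prime r-prime p∤k k≡ r∤
           in local f (p ^ suc e * l) r-prime (trans a≡ split) r∤′)
  ... | divides c b≡ | k∣b = subst₂ _∣_ (sym a≡) (trans (*-comm (p ^ suc e) c) (sym b≡))
        (*-monoʳ-∣ (p ^ suc e) (∣^*-cancel p-prime p∤k (suc e) (subst (k ∣_) (trans b≡ (*-comm c (p ^ suc e))) k∣b)))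

-- Geometric sums

geo : ℕ → ℕ → ℕ
geo x zero    = 0
geo x (suc k) = suc (x * geo x k)

geo-+ : ∀ x m n → geo x (m + n) ≡ geo x m + x ^ m * geo x n
geo-+ x zero n = sym (*-identityˡ (geo x n))
geo-+ x (suc m) n rewrite geo-+ x m n = cong suc (distrib x (geo x m) (x ^ m) (geo x n))
  where
  distrib : ∀ x g y h → x * (g + y * h) ≡ x * g + x * y * h
  distrib = solve-∀

geo-* : ∀ x m n → geo x (m * n) ≡ geo x m * geo (x ^ m) n
geo-* x m zero rewrite *-zeroʳ m = sym (*-zeroʳ (geo x m))
geo-* x m (suc n) rewrite *-suc m n | geo-+ x m (m * n) | geo-* x m n =
  factor (geo x m) (x ^ m) (geo (x ^ m) n)
  where
  factor : ∀ g y h → g + y * (g * h) ≡ g * suc (y * h)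
  factor = solve-∀

geo-snoc : ∀ x k → geo x (suc k) ≡ geo x k + x ^ k
geo-snoc x k = trans (cong (geo x) (+-comm 1 k)) (trans (geo-+ x k 1)
  (cong (λ y → geo x k + y) (trans (cong (x ^ k *_) (cong suc (*-zeroʳ x))) (*-identityʳ (x ^ k)))))

-- The base is z + 1, so that the factor x - 1 is z and no truncated subtraction occurs.
geo-closed : ∀ z k → suc (z * geo (suc z) k) ≡ suc z ^ k
geo-closed z zero = cong suc (*-zeroʳ z)
geo-closed z (suc k) rewrite sym (geo-closed z k) = expand z (geo (suc z) k)
  where
  expand : ∀ z g → suc (z * suc (suc z * g)) ≡ suc z * suc (z * g)
  expand = solve-∀

∣geo-pred : ∀ z k → geo (suc z) k ∣ pred (suc z ^ k)
∣geo-pred z k = divides z (cong pred (sym (geo-closed z k)))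

geo-mod : ∀ z k → ∃[ w ] geo (suc z) k ≡ k + z * w
geo-mod z zero = 0 , sym (*-zeroʳ z)
geo-mod z (suc k) = let w , eq = geo-mod z k in k + z * w + w , trans (cong (λ g → suc (suc z * g)) eq) (expand z k w)
  where
  expand : ∀ z k w → suc (suc z * (k + z * w)) ≡ suc k + z * (k + z * w + w)
  expand = solve-∀

-- The binomial coefficient k(k - 1)/2, which is the coefficient of z in the expansion of
-- `geo (suc z) k`.
tri : ℕ → ℕ
tri zero    = 0
tri (suc k) = k + tri k

2*tri : ∀ k → 2 * tri k + k ≡ k * k
2*tri zero = refl
2*tri (suc k) = trans (expand k (tri k)) (trans (cong (λ t → suc (k + k + t)) (2*tri k)) (collect k))
  where
  expand : ∀ k t → 2 * (k + t) + suc k ≡ suc (k + k + (2 * t + k))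
  expand = solve-∀
  collect : ∀ k → suc (k + k + k * k) ≡ suc k * suc k
  collect = solve-∀

geo-mod² : ∀ z k → ∃[ w ] geo (suc z) k ≡ k + z * tri k + z * z * w
geo-mod² z zero = 0 , sym (cong₂ _+_ (*-zeroʳ z) (*-zeroʳ (z * z)))
geo-mod² z (suc k) = let w , eq = geo-mod² z k in
  w + z * w + tri k , trans (cong (λ g → suc (suc z * g)) eq) (expand z k (tri k) w)
  where
  expand : ∀ z k t w → suc (suc z * (k + z * t + z * z * w)) ≡ suc k + z * (k + t) + z * z * (w + z * w + t)
  expand = solve-∀

odd-prime∤2 : Prime r → Odd r → r ∤ 2
odd-prime∤2 r-prime r-odd r∣2 with prime∣prime r-prime prime[2] r∣2
... | refl = r-odd ∣-refl

∣tri : Prime r → Odd r → r ∣ tri r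
∣tri {r} r-prime r-odd with euclidsLemma 2 (tri r) r-prime
  (∣m+n∣m⇒∣n (subst (r ∣_) (trans (sym (2*tri r)) (+-comm _ r)) (m∣m*n r)) ∣-refl)
... | inj₁ r∣2 = contradiction r∣2 (odd-prime∤2 r-prime r-odd)
... | inj₂ r∣t = r∣t

-- For odd r the coefficient r(r - 1)/2 is divisible by r, so every term after the first in the
-- expansion r + z · r(r - 1)/2 + z² w is divisible by r².
geo-prime-exact : Prime r → Odd r → r ∣ z → ∃[ g ] geo (suc z) r ≡ r * g × r ∤ g
geo-prime-exact {r} {z} r-prime r-odd r∣z@(divides y refl)
  with geo-mod² (y * r) r | ∣tri r-prime r-odd
... | w , eq | divides t tri≡ = suc (r * (y * t + y * y * w))
  , trans eq (trans (cong (λ T → r + y * r * T + y * r * (y * r) * w) tri≡) (collect r y t w))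
  , λ r∣ → prime∤1 r-prime (∣m+n∣m⇒∣n (subst (r ∣_) (+-comm 1 (r * (y * t + y * y * w))) r∣) (m∣m*n _))
  where
  collect : ∀ r y t w → r + y * r * (t * r) + y * r * (y * r) * w ≡ r * suc (r * (y * t + y * y * w))
  collect = solve-∀

-- Lifting the exponent: geo (1 + z) k and k are divisible by the same powers of r.
geo-lte : Prime r → Odd r → ∀ k → k > 0 → ∀ {z} → r ∣ z →
  ∃[ u ] ∃[ v ] r ∤ u × r ∤ v × u * geo (suc z) k ≡ v * k
geo-lte {r} r-prime r-odd = <-rec _ step
  where
  step : ∀ k →
    (∀ {l} → l < k → l > 0 → ∀ {z} → r ∣ z → ∃[ u ] ∃[ v ] r ∤ u × r ∤ v × u * geo (suc z) l ≡ v * l) →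
    k > 0 → ∀ {z} → r ∣ z → ∃[ u ] ∃[ v ] r ∤ u × r ∤ v × u * geo (suc z) k ≡ v * k
  step k rec k>0 {z} r∣z with r ∣? k
  ... | no r∤k = let w , eq = geo-mod z k in
    -- The sum is k modulo r, so neither side contains r and the multipliers can be taken crosswise.
    k , geo (suc z) k , r∤k
    , (λ r∣g → r∤k (∣m+n∣m⇒∣n (subst (r ∣_) (trans eq (+-comm k _)) r∣g) (∣m⇒∣m*n w r∣z)))
    , *-comm k _
  ... | yes r∣k@(divides l refl) =
    -- For k = l r the sum splits into `geo (suc z) r`, which contains r exactly once, and a sum of
    -- l terms whose base (1 + z)ʳ is again 1 modulo r.
    let instance k≢0 = >-nonZero k>0
        g , geo-r , r∤g = geo-prime-exact r-prime r-odd r∣z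
        u , v , r∤u , r∤v , eq = rec (quotient-< r∣k {{prime⇒nonTrivial r-prime}})
          (>-nonZero⁻¹ l {{quotient≢0 r∣k}}) {z * geo (suc z) r} (∣m⇒∣m*n _ r∣z)
    in u , g * v , r∤u , prime∤* r-prime r∤g r∤v , (begin
      u * geo (suc z) (l * r)                          ≡⟨ cong (λ j → u * geo (suc z) j) (*-comm l r) ⟩
      u * geo (suc z) (r * l)                          ≡⟨ cong (u *_) (geo-* (suc z) r l) ⟩
      u * (geo (suc z) r * geo (suc z ^ r) l)          ≡⟨ cong₂ (λ s x → u * (s * geo x l)) geo-r (sym (geo-closed z r)) ⟩
      u * (r * g * geo (suc (z * geo (suc z) r)) l)    ≡⟨ pull u r g _ ⟩
      r * g * (u * geo (suc (z * geo (suc z) r)) l)    ≡⟨ cong (r * g *_) eq ⟩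
      r * g * (v * l)                                  ≡⟨ push r g v l ⟩
      g * v * (l * r)                                  ∎)
    where
    open ≡-Reasoning
    pull : ∀ u r g h → u * (r * g * h) ≡ r * g * (u * h)
    pull = solve-∀
    push : ∀ r g v l → r * g * (v * l) ≡ g * v * (l * r)
    push = solve-∀

-- The divisor sum

Σ₁ : (ℕ → ℕ) → ℕ → ℕ
Σ₁ f zero    = 0
Σ₁ f (suc m) = Σ₁ f m + f (suc m)

[_]·_ : Dec P → ℕ → ℕ
[ yes _ ]· n = n
[ no _  ]· n = 0

[]·-yes : (P? : Dec P) → P → [ P? ]· n ≡ n
[]·-yes (yes _) _ = refl
[]·-yes (no ¬p) p = contradiction p ¬p

[]·-no : (P? : Dec P) → ¬ P → [ P? ]· n ≡ 0
[]·-no (yes p) ¬p = contradiction p ¬p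
[]·-no (no _)  _  = refl

[]·-cong : (P? : Dec P) (Q? : Dec Q) → (P → Q) → (Q → P) → [ P? ]· n ≡ [ Q? ]· n
[]·-cong (yes p) Q? f g = sym ([]·-yes Q? (f p))
[]·-cong (no ¬p) Q? f g = sym ([]·-no Q? (¬p ∘ g))

-- Vanishes off the divisors, so that the range of summation can be extended and rearranged freely.
divisorOf : ℕ → ℕ → ℕ
divisorOf n d = [ d ∣? n ]· d

σ≡Σ₁ : ∀ n → σ n ≡ Σ₁ (divisorOf n) n
σ≡Σ₁ n = upTo-sum n
  where
  filter-singleton : ∀ d → sum (filter (_∣? n) (d ∷ [])) ≡ divisorOf n d
  filter-singleton d with d ∣? n
  ... | yes _ = +-identityʳ d
  ... | no  _ = refl
  upTo-sum : ∀ m → sum (filter (_∣? n) (map suc (upTo m))) ≡ Σ₁ (divisorOf n) m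
  upTo-sum zero = refl
  upTo-sum (suc m) = begin
    sum (filter (_∣? n) (map suc (upTo (suc m))))
      ≡⟨ cong (λ l → sum (filter (_∣? n) (map suc l))) (upTo-∷ʳ m) ⟨
    sum (filter (_∣? n) (map suc (upTo m ∷ʳ m)))
      ≡⟨ cong (sum ∘ filter (_∣? n)) (map-++ suc (upTo m) (m ∷ [])) ⟩
    sum (filter (_∣? n) (map suc (upTo m) ∷ʳ suc m))
      ≡⟨ cong sum (filter-++ (_∣? n) (map suc (upTo m)) (suc m ∷ [])) ⟩
    sum (filter (_∣? n) (map suc (upTo m)) ++ filter (_∣? n) (suc m ∷ []))
      ≡⟨ sum-++ (filter (_∣? n) (map suc (upTo m))) _ ⟩
    sum (filter (_∣? n) (map suc (upTo m))) + sum (filter (_∣? n) (suc m ∷ []))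
      ≡⟨ cong₂ _+_ (upTo-sum m) (filter-singleton (suc m)) ⟩
    Σ₁ (divisorOf n) (suc m) ∎
    where open ≡-Reasoning

Σ₁-cong : ∀ {f g} → (∀ d → f d ≡ g d) → ∀ m → Σ₁ f m ≡ Σ₁ g m
Σ₁-cong f≗g zero    = refl
Σ₁-cong f≗g (suc m) = cong₂ _+_ (Σ₁-cong f≗g m) (f≗g (suc m))

Σ₁-+ : ∀ f g m → Σ₁ (λ d → f d + g d) m ≡ Σ₁ f m + Σ₁ g m
Σ₁-+ f g zero = refl
Σ₁-+ f g (suc m) rewrite Σ₁-+ f g m = interchange (Σ₁ f m) (Σ₁ g m) (f (suc m)) (g (suc m))
  where
  interchange : ∀ a b c d → a + b + (c + d) ≡ a + c + (b + d)
  interchange = solve-∀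

Σ₁-*ˡ : ∀ r f m → Σ₁ (λ d → r * f d) m ≡ r * Σ₁ f m
Σ₁-*ˡ r f zero = sym (*-zeroʳ r)
Σ₁-*ˡ r f (suc m) rewrite Σ₁-*ˡ r f m = sym (*-distribˡ-+ r (Σ₁ f m) (f (suc m)))

Σ₁-extend : ∀ f m k → (∀ j → j < k → f (m + suc j) ≡ 0) → Σ₁ f (m + k) ≡ Σ₁ f m
Σ₁-extend f m zero _ = cong (Σ₁ f) (+-identityʳ m)
Σ₁-extend f m (suc k) f≡0 = begin
  Σ₁ f (m + suc k)               ≡⟨ cong (Σ₁ f) (+-suc m k) ⟩
  Σ₁ f (m + k) + f (suc (m + k)) ≡⟨ cong₂ _+_ (Σ₁-extend f m k (λ j j<k → f≡0 j (m<n⇒m<1+n j<k)))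
                                       (trans (cong f (sym (+-suc m k))) (f≡0 k ≤-refl)) ⟩
  Σ₁ f m + 0                     ≡⟨ +-identityʳ _ ⟩
  Σ₁ f m                         ∎
  where open ≡-Reasoning

Σ₁-divisors : ∀ n → 0 < n → n ≤ m → Σ₁ (divisorOf n) m ≡ σ n
Σ₁-divisors {m} n 0<n n≤m = begin
  Σ₁ (divisorOf n) m             ≡⟨ cong (Σ₁ (divisorOf n)) (m+[n∸m]≡n n≤m) ⟨
  Σ₁ (divisorOf n) (n + (m ∸ n)) ≡⟨ Σ₁-extend (divisorOf n) n (m ∸ n) (λ j _ →
                                      []·-no (n + suc j ∣? n) (>⇒∤ {{>-nonZero 0<n}} (m<m+n n z<s))) ⟩
  Σ₁ (divisorOf n) n             ≡⟨ σ≡Σ₁ n ⟨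
  σ n ∎
  where open ≡-Reasoning

-- In each block of r consecutive integers only the last one, a multiple of r, contributes.
Σ₁-multiples : ∀ r f .{{_ : NonZero r}} → (∀ d → r ∤ d → f d ≡ 0) →
  ∀ m → Σ₁ f (m * r) ≡ Σ₁ (λ d → f (d * r)) m
Σ₁-multiples r f _ zero = refl
Σ₁-multiples (suc r) f f≡0 (suc m) = begin
  Σ₁ f (suc r + m * suc r)                         ≡⟨ cong (Σ₁ f) (+-comm (suc r) (m * suc r)) ⟩
  Σ₁ f (m * suc r + suc r)                         ≡⟨ cong (Σ₁ f) (+-suc (m * suc r) r) ⟩
  Σ₁ f (m * suc r + r) + f (suc (m * suc r + r))   ≡⟨ cong₂ _+_ (Σ₁-extend f (m * suc r) r λ j j<r → f≡0 _ λ r∣ →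
                                                        <⇒≱ (s≤s j<r) (∣⇒≤ (∣m+n∣m⇒∣n r∣ (n∣m*n m))))
                                                        (cong f (cong suc (+-comm (m * suc r) r))) ⟩
  Σ₁ f (m * suc r) + f (suc m * suc r)             ≡⟨ cong (_+ f (suc m * suc r)) (Σ₁-multiples (suc r) f f≡0 m) ⟩
  Σ₁ (λ d → f (d * suc r)) (suc m)                 ∎
  where open ≡-Reasoning

-- A divisor of r n is either r times a divisor of n, or prime to r and then a divisor of k.
σ-prime-* : Prime r → ∀ e → r ∤ k → n ≡ r ^ e * k → 0 < k → σ (r * n) ≡ r * σ n + σ k
σ-prime-* {r} {k} {n} r-prime e r∤k n≡ 0<k = begin
  σ (r * n)                                                     ≡⟨ σ≡Σ₁ (r * n) ⟩
  Σ₁ (divisorOf (r * n)) (r * n)                                ≡⟨ Σ₁-cong split (r * n) ⟩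
  Σ₁ (λ d → multiple d + divisorOf k d) (r * n)                 ≡⟨ Σ₁-+ multiple (divisorOf k) (r * n) ⟩
  Σ₁ multiple (r * n) + Σ₁ (divisorOf k) (r * n)                ≡⟨ cong₂ _+_ multiples (Σ₁-divisors k 0<k k≤rn) ⟩
  r * σ n + σ k                                                 ∎
  where
  open ≡-Reasoning
  instance
    r≢0 : NonZero r
    r≢0 = prime⇒nonZero r-prime
  multiple : ℕ → ℕ
  multiple d = [ r ∣? d ]· divisorOf (r * n) d
  k∣rn : k ∣ r * n
  k∣rn = ∣n⇒∣m*n r (subst (k ∣_) (sym n≡) (n∣m*n (r ^ e)))
  rn≡ : r * n ≡ r ^ suc e * k
  rn≡ = trans (cong (r *_) n≡) (sym (*-assoc r (r ^ e) k))
  k≤rn : k ≤ r * n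
  k≤rn = subst (k ≤_) (sym rn≡) (m≤n*m k (r ^ suc e) {{m^n≢0 r (suc e)}})
  split : ∀ d → divisorOf (r * n) d ≡ multiple d + divisorOf k d
  split d with r ∣? d
  ... | yes r∣d = sym (trans (cong (λ y → divisorOf (r * n) d + y)
                    ([]·-no (d ∣? k) (λ d∣k → r∤k (∣-trans r∣d d∣k)))) (+-identityʳ _))
  ... | no r∤d = []·-cong (d ∣? r * n) (d ∣? k)
                   (λ d∣ → ∣^*-cancel r-prime r∤d (suc e) (subst (d ∣_) rn≡ d∣))
                   (λ d∣k → ∣-trans d∣k k∣rn)
  []·-*ˡ : (P? : Dec P) → ∀ m → r * ([ P? ]· m) ≡ [ P? ]· (m * r)
  []·-*ˡ (yes _) m = *-comm r m
  []·-*ˡ (no _)  m = *-zeroʳ r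
  multiple-* : ∀ d → multiple (d * r) ≡ r * divisorOf n d
  multiple-* d = trans ([]·-yes (r ∣? d * r) (n∣m*n d))
    (trans ([]·-cong (d * r ∣? r * n) (d ∣? n)
              (λ dr∣rn → *-cancelˡ-∣ r (subst (_∣ r * n) (*-comm d r) dr∣rn))
              (λ d∣n → subst (_∣ r * n) (*-comm r d) (*-monoʳ-∣ r d∣n)))
           (sym ([]·-*ˡ (d ∣? n) d)))
  multiples : Σ₁ multiple (r * n) ≡ r * σ n
  multiples = begin
    Σ₁ multiple (r * n)                ≡⟨ cong (Σ₁ multiple) (*-comm r n) ⟩
    Σ₁ multiple (n * r)                ≡⟨ Σ₁-multiples r multiple (λ d → []·-no (r ∣? d)) n ⟩
    Σ₁ (λ d → multiple (d * r)) n      ≡⟨ Σ₁-cong multiple-* n ⟩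
    Σ₁ (λ d → r * divisorOf n d) n     ≡⟨ Σ₁-*ˡ r (divisorOf n) n ⟩
    r * Σ₁ (divisorOf n) n             ≡⟨ cong (r *_) (σ≡Σ₁ n) ⟨
    r * σ n                            ∎

-- The recursion of `σ-prime-*` in e is the Horner recursion that defines `geo r`.
σ-prime-power-* : Prime r → ∀ e → r ∤ k → 0 < k → σ (r ^ e * k) ≡ geo r (suc e) * σ k
σ-prime-power-* {r} {k} r-prime zero r∤k 0<k = trans (cong σ (*-identityˡ k))
  (sym (trans (cong (λ j → suc j * σ k) (*-zeroʳ r)) (*-identityˡ (σ k))))
σ-prime-power-* {r} {k} r-prime (suc e) r∤k 0<k = begin
  σ (r * r ^ e * k)                   ≡⟨ cong σ (*-assoc r (r ^ e) k) ⟩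
  σ (r * (r ^ e * k))                 ≡⟨ σ-prime-* r-prime e r∤k refl 0<k ⟩
  r * σ (r ^ e * k) + σ k             ≡⟨ cong (λ s → r * s + σ k) (σ-prime-power-* r-prime e r∤k 0<k) ⟩
  r * (geo r (suc e) * σ k) + σ k     ≡⟨ collect r (geo r (suc e)) (σ k) ⟩
  geo r (suc (suc e)) * σ k           ∎
  where
  open ≡-Reasoning
  collect : ∀ r g s → r * (g * s) + s ≡ suc (r * g) * s
  collect = solve-∀

σ-Factor : ℕ → ℕ → Set
σ-Factor p n = ∃[ r ] ∃[ e ] ∃[ k ] Prime r × n ≡ r ^ suc e * k × r ∤ k × 0 < k × p ∣ geo r (suc (suc e))

∣σ⇒factor : Prime p → ∀ n → 0 < n → p ∣ σ n → σ-Factor p n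
∣σ⇒factor {p} p-prime = <-rec _ step
  where
  step : ∀ n → (∀ {k} → k < n → 0 < k → p ∣ σ k → σ-Factor p k) → 0 < n → p ∣ σ n → σ-Factor p n
  step (suc zero) _ _ p∣1 = contradiction p∣1 (prime∤1 p-prime)
  step n@(suc (suc _)) rec _ p∣σn with prime-power-factor n (s≤s (s≤s z≤n))
  ... | r , e , k , r-prime , n≡ , r∤k , 0<k , k<n
    with euclidsLemma (geo r (suc (suc e))) (σ k) p-prime
           (subst (p ∣_) (trans (cong σ n≡) (σ-prime-power-* r-prime (suc e) r∤k 0<k)) p∣σn)
  ... | inj₁ p∣geo = r , e , k , r-prime , n≡ , r∤k , 0<k , p∣geo
  ... | inj₂ p∣σk =
    let s , f , l , s-prime , k≡ , s∤l , 0<l , p∣geo = rec k<n 0<k p∣σk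
        split , s∤ = exact-power-* {e = f} {d = suc e} r-prime s-prime r∤k k≡ s∤l
    in s , f , r ^ suc e * l , s-prime , trans n≡ split , s∤
       , n≢0⇒n>0 (λ eq → s∤ (subst (s ∣_) (sym eq) (s ∣0))) , p∣geo

-- Prime powers rᵉ ∥ n with geo r (e + 1) a power of q

even⊎odd : ∀ n → 2 ∣ n ⊎ 2 ∣ suc n
even⊎odd zero = inj₁ (2 ∣0)
even⊎odd (suc n) with even⊎odd n
... | inj₁ 2∣n  = inj₂ (∣m∣n⇒∣m+n ∣-refl 2∣n)
... | inj₂ 2∣1+n = inj₁ 2∣1+n

odd-pred : Odd n → 2 ∣ pred n
odd-pred {zero} odd = contradiction (2 ∣0) odd
odd-pred {suc n} odd with even⊎odd n
... | inj₁ 2∣n = 2∣n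
... | inj₂ 2∣1+n = contradiction 2∣1+n odd

odd^ : Odd q → ∀ a → Odd (q ^ a)
odd^ q-odd a 2∣ = q-odd (prime∣^ prime[2] a 2∣)

-- Modulo a divisor of z all k terms of the sum are 1.
∣geo⇒∣ : ∀ {m z} k → m ∣ z → m ∣ geo (suc z) k → m ∣ k
∣geo⇒∣ {m} {z} k m∣z m∣geo = let w , eq = geo-mod z k in
  ∣m+n∣m⇒∣n (subst (m ∣_) (trans eq (+-comm k (z * w))) m∣geo) (∣m⇒∣m*n w m∣z)

∣⇒∣geo : ∀ {m z} k → m ∣ z → m ∣ k → m ∣ geo (suc z) k
∣⇒∣geo {m} {z} k m∣z m∣k = let w , eq = geo-mod z k in
  subst (m ∣_) (sym eq) (∣m∣n⇒∣m+n m∣k (∣m⇒∣m*n w m∣z))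

even⇒geo-even : Odd x → ∀ k → 2 ∣ k → 2 ∣ geo x k
even⇒geo-even {zero} odd = contradiction (2 ∣0) odd
even⇒geo-even {suc z} odd k = ∣⇒∣geo k (odd-pred odd)

geo-even⇒even : Odd x → ∀ k → 2 ∣ geo x k → 2 ∣ k
geo-even⇒even {zero} odd = contradiction (2 ∣0) odd
geo-even⇒even {suc z} odd k = ∣geo⇒∣ k (odd-pred odd)

∤geo : Prime p → p ∣ x → ∀ k → p ∤ geo x (suc k)
∤geo {p} {x} p-prime p∣x k p∣geo =
  prime∤1 p-prime (∣m+n∣m⇒∣n (subst (p ∣_) (+-comm 1 (x * geo x k)) p∣geo) (∣m⇒∣m*n (geo x k) p∣x))

k<geo : 1 < x → ∀ k → 1 < k → k < geo x k
k<geo {x} 1<x (suc (suc zero)) _ =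
  s≤s (subst (1 <_) (sym (trans (cong (λ j → x * suc j) (*-zeroʳ x)) (*-identityʳ x))) 1<x)
k<geo {x} 1<x (suc k@(suc (suc _))) _ =
  s≤s (<-≤-trans (k<geo 1<x k (s≤s z<s)) (m≤n*m (geo x k) x {{>-nonZero (<-trans z<s 1<x)}}))
k<geo _ (suc zero) (s≤s ())

geo-pred : ∀ x .{{_ : NonZero x}} k → geo x k ∣ pred (x ^ k)
geo-pred (suc z) k = ∣geo-pred z k

pred-^-+ : ∀ q .{{_ : NonZero q}} a b → pred (q ^ (a + b)) ≡ q ^ a * pred (q ^ b) + pred (q ^ a)
pred-^-+ q a b rewrite ^-distribˡ-+-* q a b
  with q ^ a | q ^ b | m^n≢0 q a | m^n≢0 q b
... | suc s | suc t | _ | _ = expand s t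
  where
  expand : ∀ s t → t + s * suc t ≡ suc s * t + s
  expand = solve-∀

pred-^-* : ∀ q .{{_ : NonZero q}} a k → pred (q ^ a) * geo (q ^ a) k ≡ pred (q ^ (a * k))
pred-^-* q a k rewrite sym (^-*-assoc q a k) with q ^ a | m^n≢0 q a
... | suc w | _ = cong pred (geo-closed w k)

pred-^-∣ : ∀ q .{{_ : NonZero q}} → a ∣ b → pred (q ^ a) ∣ pred (q ^ b)
pred-^-∣ {a} q (divides k refl) = subst (λ j → pred (q ^ a) ∣ pred (q ^ j)) (*-comm a k)
  (subst (pred (q ^ a) ∣_) (pred-^-* q a k) (m∣m*n _))

∣pred-^-cancel : ∀ q .{{_ : NonZero q}} i → d + i ≡ l → m ∣ pred (q ^ i) → m ∣ pred (q ^ l) → m ∣ pred (q ^ d)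
∣pred-^-cancel {d} {m = m} q i refl m∣i m∣l =
  ∣m+n∣m⇒∣n (subst (m ∣_) (pred-^-+ q d i) m∣l) (∣n⇒∣m*n (q ^ d) m∣i)

-- Bézout's identity makes the gcd a difference of a multiple of a and a multiple of b, and
-- `∣pred-^-cancel` subtracts exponents.
∣pred-^-gcd : ∀ q .{{_ : NonZero q}} a b → m ∣ pred (q ^ a) → m ∣ pred (q ^ b) → m ∣ pred (q ^ gcd a b)
∣pred-^-gcd q a b m∣a m∣b with Bézout.identity (gcd-GCD a b)
... | Bézout.+- s t eq = ∣pred-^-cancel q (t * b) eq (∣-trans m∣b (pred-^-∣ q (n∣m*n t))) (∣-trans m∣a (pred-^-∣ q (n∣m*n s)))
... | Bézout.-+ s t eq = ∣pred-^-cancel q (s * a) eq (∣-trans m∣a (pred-^-∣ q (n∣m*n s))) (∣-trans m∣b (pred-^-∣ q (n∣m*n t)))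

-- m contains r at most once, while the exponent is at least 2.
square∣-cancel-prime : Prime r → m ≡ 1 ⊎ Prime m → ∀ g → r ^ suc (suc g) ∣ m * n → r ∣ n
square∣-cancel-prime {r} {n = n} _ (inj₁ refl) g r^∣ =
  ∣-trans (m∣m*n (r ^ suc g)) (subst (r ^ suc (suc g) ∣_) (*-identityˡ n) r^∣)
square∣-cancel-prime {r} {m} r-prime (inj₂ m-prime) g r^∣ with r ∣? m
... | no r∤m = ∣-trans (m∣m*n (r ^ suc g)) (^∣*-cancel r-prime r∤m (suc (suc g)) r^∣)
... | yes r∣m with prime∣prime r-prime m-prime r∣m
...   | refl = ∣-trans (m∣m*n (r ^ g)) (*-cancelˡ-∣ r {{prime⇒nonZero r-prime}} r^∣)

-- For e = g + 2 ≥ 2, qᵇ = 1 + r + … + rᵉ gives r ∥ qᵇ − 1, hence r ∥ qᵈ − 1 for d = gcd(b, α + 1);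
-- lifting the exponent moves the other factors r of m (q^(α+1) − 1) into m (α + 1) / d.
good-prime-power : ∀ q m M α → Prime q → m ≡ 1 ⊎ Prime m → suc α ∣ 2 * M → Prime r → Odd r → ∀ g b →
  geo r (suc (suc (suc g))) ≡ q ^ b → r ^ suc (suc g) ∣ m * geo q (suc α) →
  r ^ suc (suc g) ∣ (m * M) * (m * M)
good-prime-power {r} q m M α q-prime m-prime 1+α∣2M r-prime r-odd g b geo≡ r^∣
  with gcd b (suc α) | gcd[m,n]∣m b (suc α) | gcd[m,n]∣n b (suc α)
     | ∣pred-^-gcd {m = r} q {{prime⇒nonZero q-prime}} b (suc α)
... | d | d∣b | divides k 1+α≡ | r∣pred = square
  where
  instance
    q≢0 : NonZero q
    q≢0 = prime⇒nonZero q-prime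
    r≢0 : NonZero r
    r≢0 = prime⇒nonZero r-prime
  qᵇ-1≡ : pred (q ^ b) ≡ r * geo r (suc (suc g))
  qᵇ-1≡ = cong pred (sym geo≡)
  r∣qᵈ-1 : r ∣ pred (q ^ d)
  r∣qᵈ-1 = r∣pred (subst (r ∣_) (sym qᵇ-1≡) (m∣m*n _))
                  (∣-trans (square∣-cancel-prime r-prime m-prime g r^∣) (geo-pred q (suc α)))
  t = quotient r∣qᵈ-1
  qᵈ-1≡ : pred (q ^ d) ≡ r * t
  qᵈ-1≡ = m∣n⇒n≡m*quotient r∣qᵈ-1
  -- The cofactor of r in qᵇ - 1 is 1 modulo r, so r² divides neither qᵇ - 1 nor its divisor qᵈ - 1.
  r∤t : r ∤ t
  r∤t r∣t = ∤geo r-prime ∣-refl (suc g) (*-cancelˡ-∣ r (subst₂ _∣_ refl qᵇ-1≡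
    (∣-trans (subst (r * r ∣_) (sym qᵈ-1≡) (*-monoʳ-∣ r r∣t)) (pred-^-∣ q d∣b))))
  -- The quotient (q^(α+1) - 1)/(qᵈ - 1), where α + 1 = k d; the base is written as 1 + (qᵈ - 1) to
  -- fit `geo-lte`.
  γ = geo (suc (pred (q ^ d))) k
  q¹⁺ᵅ-1≡ : m * pred (q ^ suc α) ≡ r * (t * (m * γ))
  q¹⁺ᵅ-1≡ = begin
    m * pred (q ^ suc α)                ≡⟨ cong (λ j → m * pred (q ^ j)) (trans 1+α≡ (*-comm k d)) ⟩
    m * pred (q ^ (d * k))              ≡⟨ cong (m *_) (pred-^-* q d k) ⟨
    m * (pred (q ^ d) * geo (q ^ d) k)  ≡⟨ cong₂ (λ y x → m * (y * geo x k)) qᵈ-1≡ (sym (suc-pred (q ^ d) {{m^n≢0 q d}})) ⟩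
    m * (r * t * γ)                     ≡⟨ rearrange m r t γ ⟩
    r * (t * (m * γ))                   ∎
    where
    open ≡-Reasoning
    rearrange : ∀ m r t g → m * (r * t * g) ≡ r * (t * (m * g))
    rearrange = solve-∀
  r^∣mγ : r ^ suc g ∣ m * γ
  r^∣mγ = ^∣*-cancel r-prime r∤t (suc g) (*-cancelˡ-∣ r (subst (r ^ suc (suc g) ∣_) q¹⁺ᵅ-1≡
    (∣-trans r^∣ (*-monoʳ-∣ m (geo-pred q (suc α))))))
  k>0 : k > 0
  k>0 = n≢0⇒n>0 λ { refl → 1+n≢0 1+α≡ }
  r^∣mk : r ^ suc g ∣ m * k
  r^∣mk = let u , v , _ , r∤v , eq = geo-lte r-prime r-odd k k>0 r∣qᵈ-1
              swap = λ a b c → trans (sym (*-assoc a b c)) (trans (cong (_* c) (*-comm a b)) (*-assoc b a c))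
          in ^∣*-cancel r-prime r∤v (suc g) (subst (r ^ suc g ∣_)
               (trans (swap u m γ) (trans (cong (m *_) eq) (swap m v k))) (∣n⇒∣m*n u r^∣mγ))
  -- k divides α + 1 and hence 2 M; the 2 is dropped because r is odd.
  r^∣mM : r ^ suc g ∣ m * M
  r^∣mM = ^∣*-cancel r-prime (odd-prime∤2 r-prime r-odd) (suc g) (subst (r ^ suc g ∣_) (rearrange m M)
    (∣-trans r^∣mk (*-monoʳ-∣ m (∣-trans (subst (k ∣_) (sym 1+α≡) (m∣m*n d)) 1+α∣2M))))
    where
    rearrange : ∀ m M → m * (2 * M) ≡ 2 * (m * M)
    rearrange = solve-∀
  -- One factor r was lost on the way; squaring makes up for it, since g + 2 ≤ 2 (g + 1).
  square : r ^ suc (suc g) ∣ (m * M) * (m * M)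
  square = ∣-trans (*-monoˡ-∣ (r ^ suc g) (m∣m*n {r} (r ^ g))) (*-pres-∣ r^∣mM r^∣mM)

-- Since M will be linear in α, this bounds A by a quadratic polynomial in α, whereas σ(A) is a
-- power of q. The claim is checked on each prime power rᵉ ∥ A, whose divisor sum is again a power
-- of q.
good-part : ∀ q m M α b A → Prime q → Odd q → m ≡ 1 ⊎ Prime m → suc α ∣ 2 * M →
  A > 0 → Odd A → A ∣ m * geo q (suc α) → σ A ≡ q ^ b → A ∣ (m * M) * (m * M)
good-part q m M α b A q-prime q-odd m-prime 1+α∣2M A>0 A-odd A∣ σA≡ = prime-powers∣⇒∣ A A>0 local
  where
  local : ∀ {r} e k → Prime r → A ≡ r ^ suc e * k → r ∤ k → r ^ suc e ∣ (m * M) * (m * M)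
  local {r} e k r-prime A≡ r∤k = bound e geo≡ geo-odd (∣-trans r^∣A A∣)
    where
    r^∣A : r ^ suc e ∣ A
    r^∣A = subst (r ^ suc e ∣_) (sym A≡) (m∣m*n k)
    k>0 : k > 0
    k>0 = n≢0⇒n>0 λ { refl → r∤k (r ∣0) }
    geo∣ = ∣prime^ q-prime b (divides (σ k) (trans (sym σA≡)
      (trans (cong σ A≡) (trans (σ-prime-power-* r-prime (suc e) r∤k k>0) (*-comm _ (σ k))))))
    b′ = proj₁ geo∣
    geo≡ : geo r (suc (suc e)) ≡ q ^ b′
    geo≡ = proj₂ (proj₂ geo∣)
    r-odd : Odd r
    r-odd 2∣r = A-odd (∣-trans 2∣r (∣-trans (m∣m*n (r ^ e)) r^∣A))
    geo-odd : Odd (geo r (suc (suc e)))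
    geo-odd = subst Odd (sym geo≡) (odd^ q-odd b′)
    bound : ∀ e → geo r (suc (suc e)) ≡ q ^ b′ → Odd (geo r (suc (suc e))) →
            r ^ suc e ∣ m * geo q (suc α) → r ^ suc e ∣ (m * M) * (m * M)
    -- Exponent 1 cannot occur: 1 + r is even and a power of q is odd.
    bound zero _ odd _ = contradiction (even⇒geo-even r-odd 2 ∣-refl) odd
    bound (suc g) eq _ r^∣ = good-prime-power q m M α q-prime m-prime 1+α∣2M r-prime r-odd g b′ eq r^∣

-- The exceptional prime

prime[3] : Prime 3
prime[3] = from-yes (prime? 3)

prime[5] : Prime 5
prime[5] = from-yes (prime? 5)

^-injective : 1 < q → q ^ a ≡ q ^ b → a ≡ b
^-injective 1<q eq = ≤-antisym (^-cancel-≤ 1<q (≤-reflexive eq)) (^-cancel-≤ 1<q (≤-reflexive (sym eq)))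

^-residue : ∀ t h m n → ∃[ w ] (t + h * m) ^ n ≡ t ^ n + w * m
^-residue t h m zero = 0 , refl
^-residue t h m (suc n) = let w , eq = ^-residue t h m n in
  t * w + h * t ^ n + h * m * w , trans (cong ((t + h * m) *_) eq) (expand t h m (t ^ n) w)
  where
  expand : ∀ t h m y w → (t + h * m) * (y + w * m) ≡ t * y + (t * w + h * y + h * m * w) * m
  expand = solve-∀

-- In both cases p - 1 divides 4. What matters below is that the exponent 4 is a power of 2.
fermat⁴ : p ≡ 3 ⊎ p ≡ 5 → p ∤ r → p ∣ pred (r ^ 4)
fermat⁴ {p} {r} p≡ p∤r = by-residue p≡ (r % p) (m%n<n r p) (m≡m%n+[m/n]*n r p)
  where
  instance
    p≢0 : NonZero p
    p≢0 = [ (λ { refl → _ }) , (λ { refl → _ }) ]′ p≡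
  h = r / p
  -- s is the quotient of t⁴ - 1 by p, for each nonzero residue t.
  conclude : ∀ t s → t ^ 4 ≡ suc (s * p) → r ≡ t + h * p → p ∣ pred (r ^ 4)
  conclude t s t⁴≡ r≡ = let w , eq = ^-residue t h p 4 in
    subst (λ x → p ∣ pred x) (sym (trans (cong (_^ 4) r≡) (trans eq (cong (_+ w * p) t⁴≡)))) (∣m∣n⇒∣m+n (n∣m*n s) (n∣m*n w))
  by-residue : p ≡ 3 ⊎ p ≡ 5 → ∀ t → t < p → r ≡ t + h * p → p ∣ pred (r ^ 4)
  by-residue _ 0 _ r≡ = contradiction (subst (p ∣_) (sym r≡) (n∣m*n h)) p∤r
  by-residue _ 1 _ r≡ = conclude 1 0 refl r≡
  by-residue (inj₁ refl) 2 _ r≡ = conclude 2 5 refl r≡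
  by-residue (inj₁ refl) (suc (suc (suc _))) (s≤s (s≤s (s≤s ()))) _
  by-residue (inj₂ refl) 2 _ r≡ = conclude 2 3 refl r≡
  by-residue (inj₂ refl) 3 _ r≡ = conclude 3 16 refl r≡
  by-residue (inj₂ refl) 4 _ r≡ = conclude 4 51 refl r≡
  by-residue (inj₂ refl) (suc (suc (suc (suc (suc _))))) (s≤s (s≤s (s≤s (s≤s (s≤s ()))))) _

-- The order of r modulo p divides both p − 1, a power of 2, and the odd number j.
∣geo⇒≡1 : p ≡ 3 ⊎ p ≡ 5 → ∀ j → Odd (suc j) → .{{_ : NonZero r}} → p ∣ geo r (suc j) → p ∣ pred r
∣geo⇒≡1 {p} {r} p≡ j j-odd p∣geo = subst (p ∣_) (cong pred (trans (cong (r ^_) gcd≡1) (*-identityʳ r)))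
  (∣pred-^-gcd r (suc j) 4 (∣-trans p∣geo (geo-pred r (suc j))) (fermat⁴ {r = r} p≡ λ p∣r → ∤geo p-prime p∣r j p∣geo))
  where
  p-prime : Prime p
  p-prime = [ (λ { refl → prime[3] }) , (λ { refl → prime[5] }) ]′ p≡
  gcd≡1 : gcd (suc j) 4 ≡ 1
  gcd≡1 with gcd (suc j) 4 | gcd[m,n]∣m (suc j) 4 | ∣prime^ prime[2] 2 (gcd[m,n]∣n (suc j) 4)
  ... | _ | _    | zero , _ , refl = refl
  ... | _ | g∣j | suc b , _ , refl = contradiction (∣-trans (m∣m*n (2 ^ b)) g∣j) j-odd

-- Once r ≡ 1 modulo p, the sum factors as geo r p · geo (rᵖ) k with q dividing rᵖ − 1,
-- and lifting the exponent shows that the second factor is a power of q only for k = 1.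
geo≡prime*prime^ : Prime q → Odd q → Prime p → Prime r → p ∣ pred r → ∀ j → j > 0 →
  geo r j ≡ p * q ^ c → j ≡ p
geo≡prime*prime^ {q} {p} {r} {c} q-prime q-odd p-prime r-prime p∣r-1 j j>0 geo≡ =
  factor p∣j
  where
  instance
    r≢0 : NonZero r
    r≢0 = prime⇒nonZero r-prime
    p≢0 : NonZero p
    p≢0 = prime⇒nonZero p-prime
  p∣j : p ∣ j
  p∣j = ∣geo⇒∣ j p∣r-1 (subst (λ x → p ∣ geo x j) (sym (suc-pred r)) (divides (q ^ c) (trans geo≡ (*-comm p _))))
  p∣geo : p ∣ geo r p
  p∣geo = subst (λ x → p ∣ geo x p) (suc-pred r) (∣⇒∣geo p p∣r-1 ∣-refl)
  p<geo : p < geo r p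
  p<geo = k<geo (prime≥2 r-prime) p (prime≥2 p-prime)
  s = quotient p∣geo
  w = pred (r ^ p)
  rᵖ≡ : suc w ≡ r ^ p
  rᵖ≡ = suc-pred (r ^ p) {{m^n≢0 r p}}
  factor : p ∣ j → j ≡ p
  factor (divides k refl) = trans (cong (_* p) (k≡1 k k*geo≡)) (*-identityˡ p)
    where
    k*geo≡ : s * geo (suc w) k ≡ q ^ c
    k*geo≡ = *-cancelˡ-≡ _ _ p (begin
      p * (s * geo (suc w) k)   ≡⟨ *-assoc p s _ ⟨
      p * s * geo (suc w) k     ≡⟨ cong₂ (λ x y → x * geo y k) (sym (m∣n⇒n≡m*quotient p∣geo)) rᵖ≡ ⟩
      geo r p * geo (r ^ p) k   ≡⟨ geo-* r p k ⟨
      geo r (p * k)             ≡⟨ cong (geo r) (*-comm p k) ⟩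
      geo r (k * p)             ≡⟨ geo≡ ⟩
      p * q ^ c                 ∎)
      where open ≡-Reasoning
    -- s divides a power of q, and it is not 1 because `geo r p` exceeds p.
    q∣s : q ∣ s
    q∣s with ∣prime^ {d = s} q-prime c (subst (s ∣_) k*geo≡ (m∣m*n _))
    ... | zero , _ , s≡1 = contradiction p<geo (<-irrefl (sym (trans (m∣n⇒n≡m*quotient p∣geo)
                             (trans (cong (p *_) s≡1) (*-identityʳ p)))))
    ... | suc b , _ , s≡ = subst (q ∣_) (sym s≡) (m∣m*n (q ^ b))
    q∣w : q ∣ w
    q∣w = ∣-trans (∣-trans q∣s (quotient-∣ p∣geo)) (geo-pred r p)
    k≡1 : ∀ k → s * geo (suc w) k ≡ q ^ c → k ≡ 1
    k≡1 zero eq = contradiction (trans (sym eq) (*-zeroʳ s)) (≢-nonZero⁻¹ (q ^ c) {{m^n≢0 q c {{prime⇒nonZero q-prime}}}})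
    k≡1 (suc zero) _ = refl
    -- For k ≥ 2 the second factor is a power of q, and since q | w, lifting the exponent makes this
    -- power divide k. But k is smaller than the sum.
    k≡1 k@(suc (suc _)) eq with ∣prime^ q-prime c (subst (geo (suc w) k ∣_) eq (n∣m*n s))
    ... | b , _ , geo≡qᵇ =
      let u , v , _ , q∤v , lte = geo-lte q-prime q-odd k z<s q∣w
          qᵇ∣k = ^∣*-cancel q-prime q∤v b (subst (q ^ b ∣_) lte (∣n⇒∣m*n u (subst (q ^ b ∣_) (sym geo≡qᵇ) ∣-refl)))
          1<rᵖ = subst (1 <_) (sym rᵖ≡) (<-≤-trans (prime≥2 r-prime) (m≤m^n r p))
      in contradiction (k<geo 1<rᵖ k (s≤s z<s)) (≤⇒≯ (subst (_≤ k) (sym geo≡qᵇ) (∣⇒≤ qᵇ∣k)))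
      where
      m≤m^n : ∀ m .{{_ : NonZero m}} n .{{_ : NonZero n}} → m ≤ m ^ n
      m≤m^n m (suc n) = m≤m*n m (m ^ n) {{m^n≢0 m n}}

-- `geo ρ p` is σ(ρ^(p-1)), the part of σ(n) that carries the factor p; the other part σ(A) is a
-- pure power of q.
record ExceptionalPrime (q p α n : ℕ) : Set where
  field
    ρ A γ β  : ℕ
    ρ-prime  : Prime ρ
    p∣ρ-1    : p ∣ pred ρ
    n≡       : n ≡ ρ ^ pred p * A
    A>0      : A > 0
    geo≡     : geo ρ p ≡ p * q ^ γ
    γ+β≡α    : γ + β ≡ α
    σA≡      : σ A ≡ q ^ β

-- Some prime power rᵉ ∥ n has p | σ(rᵉ). After cancelling p, the two remaining factors multiply to
-- q^α, so each is a power of q, and `geo≡prime*prime^` fixes the exponent.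
exceptional-prime : Prime q → Odd q → Prime p → p ≡ 2 ⊎ p ≡ 3 ⊎ p ≡ 5 →
  ∀ {α n} → n > 0 → Odd n → σ n ≡ p * q ^ α → ExceptionalPrime q p α n
exceptional-prime {q} {p} q-prime q-odd p-prime p≡ {α} {n} n>0 n-odd σn≡ =
  analyse (∣σ⇒factor p-prime n n>0 (subst (p ∣_) (sym σn≡) (m∣m*n (q ^ α))))
  where
  instance
    p≢0 : NonZero p
    p≢0 = prime⇒nonZero p-prime
  analyse : σ-Factor p n → ExceptionalPrime q p α n
  analyse (r , e , k , r-prime , n≡ , r∤k , 0<k , p∣geo) = record
    { ρ = r; A = k; γ = γ; β = β; ρ-prime = r-prime; p∣ρ-1 = p∣r-1
    ; n≡ = trans n≡ (cong (λ i → r ^ pred i * k) e≡) ; A>0 = 0<k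
    ; geo≡ = subst (λ i → geo r i ≡ p * q ^ γ) e≡ geo≡
    ; γ+β≡α = ^-injective (prime≥2 q-prime) (trans (^-distribˡ-+-* q γ β) (trans (sym (cong₂ _*_ g≡ σk≡)) gσ≡))
    ; σA≡ = σk≡ }
    where
    g = quotient p∣geo
    gσ≡ : g * σ k ≡ q ^ α
    gσ≡ = *-cancelˡ-≡ _ _ p (begin
      p * (g * σ k)                ≡⟨ *-assoc p g (σ k) ⟨
      p * g * σ k                  ≡⟨ cong (_* σ k) (m∣n⇒n≡m*quotient p∣geo) ⟨
      geo r (suc (suc e)) * σ k    ≡⟨ σ-prime-power-* r-prime (suc e) r∤k 0<k ⟨
      σ (r ^ suc e * k)            ≡⟨ cong σ n≡ ⟨
      σ n                          ≡⟨ σn≡ ⟩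
      p * q ^ α                    ∎)
      where open ≡-Reasoning
    g-power = ∣prime^ {d = g} q-prime α (subst (g ∣_) gσ≡ (m∣m*n (σ k)))
    σ-power = ∣prime^ {d = σ k} q-prime α (subst (σ k ∣_) gσ≡ (n∣m*n g))
    γ = proj₁ g-power
    β = proj₁ σ-power
    g≡ : g ≡ q ^ γ
    g≡ = proj₂ (proj₂ g-power)
    σk≡ : σ k ≡ q ^ β
    σk≡ = proj₂ (proj₂ σ-power)
    geo≡ : geo r (suc (suc e)) ≡ p * q ^ γ
    geo≡ = trans (m∣n⇒n≡m*quotient p∣geo) (cong (p *_) g≡)
    r-odd : Odd r
    r-odd 2∣r = n-odd (subst (2 ∣_) (sym n≡) (∣m⇒∣m*n k (∣m⇒∣m*n (r ^ e) 2∣r)))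
    geo-odd : Odd p → Odd (geo r (suc (suc e)))
    geo-odd p-odd = subst Odd (sym geo≡) (prime∤* prime[2] p-odd (odd^ q-odd γ))
    p∣r-1 : p ∣ pred r
    p∣r-1 = [ (λ { refl → odd-pred r-odd }) , odd-case ]′ p≡
      where
      odd-case : p ≡ 3 ⊎ p ≡ 5 → p ∣ pred r
      -- The sum p q^γ is odd, hence so is its number of terms.
      odd-case p≡3⊎5 = ∣geo⇒≡1 p≡3⊎5 (suc e) (geo-odd p-odd ∘ even⇒geo-even r-odd (suc (suc e)))
                         {{prime⇒nonZero r-prime}} p∣geo
        where
        p-odd : Odd p
        p-odd = [ (λ { refl → from-no (2 ∣? 3) }) , (λ { refl → from-no (2 ∣? 5) }) ]′ p≡3⊎5
    e≡ : suc (suc e) ≡ p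
    e≡ = geo≡prime*prime^ {c = γ} q-prime q-odd p-prime r-prime p∣r-1 (suc (suc e)) z<s geo≡

-- Excluding the small ratios

-- What is left of a perfect number N = qᵅ n when σ(n) = m qᵅ.
record Cofactor (q α n m : ℕ) : Set where
  field
    q-prime : Prime q
    q-odd   : Odd q
    q∤n     : q ∤ n
    n>0     : n > 0
    n-odd   : Odd n
    σn≡     : σ n ≡ m * q ^ α
    2n≡     : 2 * n ≡ m * geo q (suc α)

-- Exponentials against quadratic polynomials.

outgrow : ∀ (f : ℕ → ℕ) c x .{{_ : NonZero x}} → (∀ k → f (suc k) ≤ x * f k) → f 0 < c → ∀ k → f k < c * x ^ k
outgrow f c x f-step f₀<c zero = subst (f 0 <_) (sym (*-identityʳ c)) f₀<c
outgrow f c x f-step f₀<c (suc k) = begin-strict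
  f (suc k)          ≤⟨ f-step k ⟩
  x * f k            <⟨ *-monoʳ-< x (outgrow f c x f-step f₀<c k) ⟩
  x * (c * x ^ k)    ≡⟨ swap x c (x ^ k) ⟩
  c * (x * x ^ k)    ∎
  where
  open ≤-Reasoning
  swap : ∀ x c y → x * (c * y) ≡ c * (x * y)
  swap = solve-∀

-- In the estimates below d is a polynomial with natural coefficients, which reduces an inequality
-- to a ring identity.
slack : ∀ d → m + d ≡ n → m ≤ n
slack {m} d eq = subst (m ≤_) eq (m≤m+n m d)

-- For the case m = 1: with α = 2 k + 1 the right side is 3^α, and n will be at most (k + 1)².
2[1+k]²<3*9^k : ∀ k → 2 * (suc k * suc k) < 3 * 9 ^ k
2[1+k]²<3*9^k = outgrow (λ k → 2 * (suc k * suc k)) 3 9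
  (λ k → slack (2 * (8 * (k * k) + 14 * k + 5)) (expand k)) (s≤s (s≤s (s≤s z≤n)))
  where
  expand : ∀ k → 2 * (suc (suc k) * suc (suc k)) + 2 * (8 * (k * k) + 14 * k + 5)
    ≡ 9 * (2 * (suc k * suc k))
  expand = solve-∀

-- For m = 3 and m = 5, where q ≥ 13 and 50 = 2 · 5². The exponents 1 and 2, for which the
-- inequality fails, are excluded separately.
50[3+k]²<13^[3+k] : ∀ k → 50 * ((3 + k) * (3 + k)) < 13 ^ (3 + k)
50[3+k]²<13^[3+k] k = subst (50 * ((3 + k) * (3 + k)) <_) (sym (^-distribˡ-+-* 13 3 k))
  (outgrow (λ k → 50 * ((3 + k) * (3 + k))) (13 ^ 3) 13
    (λ k → slack (50 * (12 * (k * k) + 70 * k + 101)) (expand k)) (<ᵇ⇒< _ _ _) k)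
  where
  expand : ∀ k → 50 * ((4 + k) * (4 + k)) + 50 * (12 * (k * k) + 70 * k + 101) ≡ 13 * (50 * ((3 + k) * (3 + k)))
  expand = solve-∀

2[15+4k]²<9*5^[3+k] : ∀ k → 2 * ((15 + 4 * k) * (15 + 4 * k)) < 9 * 5 ^ (3 + k)
2[15+4k]²<9*5^[3+k] k = subst (2 * ((15 + 4 * k) * (15 + 4 * k)) <_)
  (trans (*-assoc 9 (5 ^ 3) (5 ^ k)) (cong (9 *_) (sym (^-distribˡ-+-* 5 3 k))))
  (outgrow (λ k → 2 * ((15 + 4 * k) * (15 + 4 * k))) (9 * 5 ^ 3) 5
    (λ k → slack (2 * (64 * (k * k) + 448 * k + 764)) (expand k)) (<ᵇ⇒< _ _ _) k)
  where
  expand : ∀ k → 2 * ((15 + 4 * suc k) * (15 + 4 * suc k)) + 2 * (64 * (k * k) + 448 * k + 764)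
    ≡ 5 * (2 * ((15 + 4 * k) * (15 + 4 * k)))
  expand = solve-∀

2[27+4k]²<9*3^[6+k] : ∀ k → 2 * ((27 + 4 * k) * (27 + 4 * k)) < 9 * 3 ^ (6 + k)
2[27+4k]²<9*3^[6+k] k = subst (2 * ((27 + 4 * k) * (27 + 4 * k)) <_)
  (trans (*-assoc 9 (3 ^ 6) (3 ^ k)) (cong (9 *_) (sym (^-distribˡ-+-* 3 6 k))))
  (outgrow (λ k → 2 * ((27 + 4 * k) * (27 + 4 * k))) (9 * 3 ^ 6) 3
    (λ k → slack (2 * (32 * (k * k) + 400 * k + 1226)) (expand k)) (<ᵇ⇒< _ _ _) k)
  where
  expand : ∀ k → 2 * ((27 + 4 * suc k) * (27 + 4 * suc k)) + 2 * (32 * (k * k) + 400 * k + 1226)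
    ≡ 3 * (2 * ((27 + 4 * k) * (27 + 4 * k)))
  expand = solve-∀

∤pred : 1 < x → x ∤ pred x
∤pred {suc (suc k)} _ x∣ = <⇒≱ (n<1+n (suc k)) (∣⇒≤ x∣)
∤pred {suc zero} (s≤s ())

^≤geo : ∀ x k → x ^ k ≤ geo x (suc k)
^≤geo x k = subst (x ^ k ≤_) (sym (geo-snoc x k)) (m≤n+m (x ^ k) (geo x k))

odd-prime≥3 : Prime q → Odd q → 3 ≤ q
odd-prime≥3 {q} q-prime q-odd = ≤∧≢⇒< (prime≥2 q-prime) λ { refl → q-odd ∣-refl }

-- `geo 3 4` is 40 and 3⁴ is prime to 5, so k can be lowered by 4; the odd starting values 1 and 3
-- give 1 and 13.
5∣geo3⇒even : ∀ k → 5 ∣ geo 3 k → 2 ∣ k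
5∣geo3⇒even 0 _ = 2 ∣0
5∣geo3⇒even 1 5∣ = contradiction 5∣ (from-no (5 ∣? 1))
5∣geo3⇒even 2 _ = ∣-refl
5∣geo3⇒even 3 5∣ = contradiction 5∣ (from-no (5 ∣? 13))
5∣geo3⇒even (suc (suc (suc (suc k)))) 5∣ = ∣m∣n⇒∣m+n (divides 2 refl) (5∣geo3⇒even k
  (∣^*-cancel prime[3] (from-no (3 ∣? 5)) 4 (∣m+n∣m⇒∣n (subst (5 ∣_) (geo-+ 3 4 k) 5∣) (divides 8 refl))))

-- The ratios 0, 1 and 4, and the bounds for a prime ratio.

module _ {q α n m} (N : Cofactor q α n m) where
  open Cofactor N

  -- 2 n = m (1 + q + ... + q^α) makes the sum even, and with q odd its number of terms is even too.
  odd-case : Odd m → ∃[ u ] u > 0 × suc α ≡ 2 * u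
  odd-case m-odd with euclidsLemma m (geo q (suc α)) prime[2] (subst (2 ∣_) 2n≡ (m∣m*n n))
  ... | inj₁ 2∣m = contradiction 2∣m m-odd
  ... | inj₂ 2∣geo with geo-even⇒even q-odd (suc α) 2∣geo
  ...   | divides (suc u) 1+α≡ = suc u , z<s , trans 1+α≡ (*-comm (suc u) 2)

  -- Here σ(n) itself is a power of q, so `good-part` applies to all of n and gives n ≤ u² for α + 1
  -- = 2 u, against q^α ≤ 2 n.
  m≢1 : m ≢ 1
  m≢1 refl with odd-case (from-no (2 ∣? 1))
  ... | suc v , _ , 1+α≡ = contradiction chain (<⇒≱ (2[1+k]²<3*9^k v))
    where
    u = suc v
    n≤u² : n ≤ u * u
    n≤u² = ∣⇒≤ (subst (n ∣_) (cong₂ _*_ (*-identityˡ u) (*-identityˡ u))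
      (good-part q 1 u α α n q-prime q-odd (inj₁ refl) (∣-reflexive 1+α≡) n>0 n-odd
        (subst (n ∣_) 2n≡ (n∣m*n 2)) (trans σn≡ (*-identityˡ (q ^ α)))))
    α≡ : α ≡ suc (2 * v)
    α≡ = suc-injective (trans 1+α≡ (*-suc 2 v))
    chain : 3 * 9 ^ v ≤ 2 * (u * u)
    chain = begin
      3 * 9 ^ v               ≡⟨ cong (3 *_) (^-*-assoc 3 2 v) ⟩
      3 ^ suc (2 * v)         ≡⟨ cong (3 ^_) α≡ ⟨
      3 ^ α                   ≤⟨ ^-monoˡ-≤ α (odd-prime≥3 q-prime q-odd) ⟩
      q ^ α                   ≤⟨ ^≤geo q α ⟩
      geo q (suc α)           ≡⟨ *-identityˡ _ ⟨
      1 * geo q (suc α)       ≡⟨ 2n≡ ⟨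
      2 * n                   ≤⟨ *-monoʳ-≤ 2 n≤u² ⟩
      2 * (u * u)             ∎
      where open ≤-Reasoning

  m≢4 : m ≢ 4
  m≢4 refl = n-odd (divides (geo q (suc α)) (*-cancelˡ-≡ n _ 2 (trans 2n≡ (regroup (geo q (suc α))))))
    where
    regroup : ∀ g → 4 * g ≡ 2 * (g * 2)
    regroup = solve-∀

  m≢0 : m ≢ 0
  m≢0 refl = contradiction n>0 (λ { n>0 → <-irrefl (sym (*-cancelˡ-≡ n 0 2 2n≡)) n>0 })

  module _ (m-prime : Prime m) (E : ExceptionalPrime q m α n) where
    open ExceptionalPrime E

    cofactor-odd : Odd A
    cofactor-odd 2∣A = n-odd (subst (2 ∣_) (sym n≡) (∣n⇒∣m*n (ρ ^ pred m) 2∣A))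

    cofactor∣ : ∀ M → suc α ∣ 2 * M → A ∣ (m * M) * (m * M)
    cofactor∣ M 1+α∣2M = good-part q m M α β A q-prime q-odd (inj₂ m-prime) 1+α∣2M A>0 cofactor-odd
      (subst (A ∣_) 2n≡ (∣n⇒∣m*n 2 (subst (A ∣_) (sym n≡) (n∣m*n (ρ ^ pred m))))) σA≡

    ρ^∣geo : ρ ^ pred m ∣ geo q (suc α)
    ρ^∣geo = ^∣*-cancel ρ-prime ρ∤m (pred m)
      (subst (ρ ^ pred m ∣_) 2n≡ (∣n⇒∣m*n 2 (subst (ρ ^ pred m ∣_) (sym n≡) (m∣m*n A))))
      where
      ρ∤m : ρ ∤ m
      ρ∤m ρ∣m = ∤pred (prime≥2 ρ-prime) (∣-trans ρ∣m p∣ρ-1)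

    -- Compare m q^α ≤ 2 n = 2 ρ^(m-1) A with ρ^(m-1) ≤ `geo ρ m` = m q^γ, and cancel m q^γ.
    qᵝ≤2A : q ^ β ≤ 2 * A
    qᵝ≤2A = *-cancelˡ-≤ (m * q ^ γ) {{m*n≢0 m (q ^ γ) {{prime⇒nonZero m-prime}} {{m^n≢0 q γ {{prime⇒nonZero q-prime}}}}}} (begin
      m * q ^ γ * q ^ β        ≡⟨ *-assoc m (q ^ γ) (q ^ β) ⟩
      m * (q ^ γ * q ^ β)      ≡⟨ cong (m *_) (^-distribˡ-+-* q γ β) ⟨
      m * q ^ (γ + β)          ≡⟨ cong (λ i → m * q ^ i) γ+β≡α ⟩
      m * q ^ α                ≤⟨ *-monoʳ-≤ m (^≤geo q α) ⟩
      m * geo q (suc α)        ≡⟨ 2n≡ ⟨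
      2 * n                    ≡⟨ cong (2 *_) n≡ ⟩
      2 * (ρ ^ pred m * A)     ≤⟨ *-monoʳ-≤ 2 (*-monoˡ-≤ A ρ^≤) ⟩
      2 * (m * q ^ γ * A)      ≡⟨ swap (m * q ^ γ) A ⟩
      m * q ^ γ * (2 * A)      ∎)
      where
      open ≤-Reasoning
      swap : ∀ x a → 2 * (x * a) ≡ x * (2 * a)
      swap = solve-∀
      ρ^≤ : ρ ^ pred m ≤ m * q ^ γ
      ρ^≤ = subst (ρ ^ pred m ≤_) (trans (cong (geo ρ) (suc-pred m {{prime⇒nonZero m-prime}})) geo≡) (^≤geo ρ (pred m))

    γ>0 : γ > 0
    γ>0 = n≢0⇒n>0 λ γ≡0 → <-irrefl (sym (trans geo≡ (trans (cong (λ i → m * q ^ i) γ≡0) (*-identityʳ m))))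
      (k<geo (prime≥2 ρ-prime) m (prime≥2 m-prime))

-- From (x−1) geo x m = xᵐ − 1 and m qᶜ = geo x m one gets −qˡ ≡ m (x−1) modulo x^(m−1) when q^(c+l) ≡ 1.
exceptional-∣ : ∀ x m .{{_ : NonZero x}} .{{_ : NonZero m}} .{{_ : NonZero q}} →
  x ^ pred m ∣ pred (q ^ (c + l)) → geo x m ≡ m * q ^ c → x ^ pred m ∣ q ^ l + m * pred x
exceptional-∣ {q} {c} {l} (suc s) m@(suc μ) (divides t eq) geo≡ =
  ∣m+n∣m⇒∣n (subst (D ∣_) (trans identity (+-comm _ (m * s * (t * D)))) (∣m∣n⇒∣m+n (n∣m*n (q ^ l)) (n∣m*n (s * q ^ l))))
            (∣n⇒∣m*n (m * s) (n∣m*n t))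
  where
  D = suc s ^ μ
  G = geo (suc s) μ
  open ≡-Reasoning
  q^≡ : q ^ c * q ^ l ≡ suc (t * D)
  q^≡ = trans (sym (^-distribˡ-+-* q c l)) (trans (sym (suc-pred (q ^ (c + l)) {{m^n≢0 q (c + l)}})) (cong suc eq))
  identity : q ^ l * D + s * q ^ l * D ≡ q ^ l + m * s + m * s * (t * D)
  identity = begin
    q ^ l * D + s * q ^ l * D              ≡⟨ cong (λ d → q ^ l * d + s * q ^ l * D) (geo-closed s μ) ⟨
    q ^ l * suc (s * G) + s * q ^ l * D    ≡⟨ collect (q ^ l) s G D ⟩
    q ^ l + s * q ^ l * (G + D)            ≡⟨ cong (λ g → q ^ l + s * q ^ l * g) (trans (sym (geo-snoc (suc s) μ)) geo≡) ⟩
    q ^ l + s * q ^ l * (m * q ^ c)        ≡⟨ rearrange (q ^ l) s m (q ^ c) ⟩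
    q ^ l + m * s * (q ^ c * q ^ l)        ≡⟨ cong (λ y → q ^ l + m * s * y) q^≡ ⟩
    q ^ l + m * s * suc (t * D)            ≡⟨ distrib (q ^ l) m s (t * D) ⟩
    q ^ l + m * s + m * s * (t * D)        ∎
    where
    collect : ∀ y s g d → y * suc (s * g) + s * y * d ≡ y + s * y * (g + d)
    collect = solve-∀
    rearrange : ∀ y s m z → y + s * y * (m * z) ≡ y + m * s * (z * y)
    rearrange = solve-∀
    distrib : ∀ y m s d → y + m * s * suc d ≡ y + m * s + m * s * d
    distrib = solve-∀

-- Apart from 5, the odd primes below 13 are 3, 7 and 11, all of them 3 modulo 4.
small-primes : ∀ q → Prime q → Odd q → q < 13 → q ≡ 5 ⊎ 4 ∣ geo q 2
small-primes 0 q-prime _ _ = contradiction q-prime ¬prime[0]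
small-primes 1 q-prime _ _ = contradiction q-prime ¬prime[1]
small-primes 2 _ odd _ = contradiction ∣-refl odd
small-primes 3 _ _ _ = inj₂ (divides 1 refl)
small-primes 4 _ odd _ = contradiction (divides 2 refl) odd
small-primes 5 _ _ _ = inj₁ refl
small-primes 6 _ odd _ = contradiction (divides 3 refl) odd
small-primes 7 _ _ _ = inj₂ (divides 2 refl)
small-primes 8 _ odd _ = contradiction (divides 4 refl) odd
small-primes 9 q-prime _ _ = contradiction q-prime (from-no (prime? 9))
small-primes 10 _ odd _ = contradiction (divides 5 refl) odd
small-primes 11 _ _ _ = inj₂ (divides 3 refl)
small-primes 12 _ odd _ = contradiction (divides 6 refl) odd
small-primes (suc (suc (suc (suc (suc (suc (suc (suc (suc (suc (suc (suc (suc q))))))))))))) _ _ q<13 =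
  contradiction q<13 (≤⇒≯ (m≤m+n 13 q))

exceptional-bound₃ : ∀ s → 4 ≤ s → geo (suc s) 2 + 3 * (3 * s) < 2 * suc s ^ 2
exceptional-bound₃ (suc (suc (suc (suc t)))) _ = slack (7 + 10 * t + 2 * (t * t)) (expand t)
  where
  expand : ∀ t → suc (suc ((5 + t) * suc ((5 + t) * 0)) + 3 * (3 * (4 + t))) + (7 + 10 * t + 2 * (t * t)) ≡ 2 * ((5 + t) * ((5 + t) * 1))
  expand = solve-∀
exceptional-bound₃ 1 (s≤s ())
exceptional-bound₃ 2 (s≤s (s≤s ()))
exceptional-bound₃ 3 (s≤s (s≤s (s≤s ())))

exceptional-bound₅ : ∀ s → 1 ≤ s → geo (suc s) 4 + 5 * (5 * s) < 4 * suc s ^ 4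
exceptional-bound₅ (suc t) _ = slack (23 + 86 * t + 89 * (t * t) + 31 * (t * t * t) + 4 * (t * t * t * t)) (expand t)
  where
  expand : ∀ t → suc (suc ((2 + t) * suc ((2 + t) * suc ((2 + t) * suc ((2 + t) * 0)))) + 5 * (5 * (1 + t)))
      + (23 + 86 * t + 89 * (t * t) + 31 * (t * t * t) + 4 * (t * t * t * t))
    ≡ 4 * ((2 + t) * ((2 + t) * ((2 + t) * ((2 + t) * 1))))
  expand = solve-∀

-- Contradicts m p^(m-1) ≤ `geo p m` + m² (p - 1) once the leading term p^(m-1) of the sum is
-- cancelled.
exceptional-bound : m ≡ 3 ⊎ m ≡ 5 → Prime p → Odd p → m ∣ pred p →
  geo p (pred m) + m * (m * pred p) < pred m * p ^ pred m
exceptional-bound {p = p} (inj₁ refl) p-prime p-odd 3∣p-1 = subst (λ x → geo x 2 + 3 * (3 * pred p) < 2 * x ^ 2)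
  (suc-pred p {{prime⇒nonZero p-prime}}) (exceptional-bound₃ (pred p) (4≤p-1 (odd-pred p-odd) 3∣p-1))
  where
  -- Here 6 divides p - 1; the estimate for m = 3 fails when p - 1 < 4.
  4≤p-1 : 2 ∣ pred p → 3 ∣ pred p → 4 ≤ pred p
  4≤p-1 2∣ 3∣ = ≤-trans (m≤m+n 4 2) (∣⇒≤ {{>-nonZero (pred-mono-≤ (prime≥2 p-prime))}}
    (subst (6 ∣_) (sym (m∣n⇒n≡m*quotient 3∣)) (*-monoʳ-∣ 3 (∣^*-cancel {n = quotient 3∣} prime[3] (from-no (3 ∣? 2)) 1
      (subst (2 ∣_) (m∣n⇒n≡m*quotient 3∣) 2∣)))))
exceptional-bound {p = p} (inj₂ refl) p-prime p-odd 5∣p-1 = subst (λ x → geo x 4 + 5 * (5 * pred p) < 4 * x ^ 4)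
  (suc-pred p {{prime⇒nonZero p-prime}}) (exceptional-bound₅ (pred p) (pred-mono-≤ (prime≥2 p-prime)))

-- The ratios 3 and 5.

module _ {q α n m} (N : Cofactor q α n m) where
  open Cofactor N

  private
    instance
      q≢0 : NonZero q
      q≢0 = prime⇒nonZero q-prime

  -- For α + 1 = 2 u, the facts q ≥ 13 and u ≤ β turn q^β ≤ 2 A ≤ 2 (m u)² into 13ᵘ ≤ 50 u².
  odd-prime-case : m ≡ 3 ⊎ m ≡ 5 → ⊥
  odd-prime-case m≡ = main (odd-case N m-odd)
    where
    m-odd : Odd m
    m-odd = [ (λ { refl → from-no (2 ∣? 3) }) , (λ { refl → from-no (2 ∣? 5) }) ]′ m≡
    m-prime : Prime m
    m-prime = [ (λ { refl → prime[3] }) , (λ { refl → prime[5] }) ]′ m≡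
    m≤5 : m ≤ 5
    m≤5 = [ (λ { refl → m≤m+n 3 2 }) , (λ { refl → ≤-refl }) ]′ m≡
    E : ExceptionalPrime q m α n
    E = exceptional-prime q-prime q-odd m-prime (inj₂ m≡) n>0 n-odd σn≡
    open ExceptionalPrime E
    instance
      0≢m : NonZero m
      0≢m = prime⇒nonZero m-prime
      ρ≢0 : NonZero ρ
      ρ≢0 = prime⇒nonZero ρ-prime

    4∤geo : 4 ∤ geo q (suc α)
    4∤geo 4∣ = n-odd (*-cancelˡ-∣ 2 (subst (4 ∣_) (sym 2n≡) (∣n⇒∣m*n m 4∣)))

    ρ-odd : Odd ρ
    ρ-odd 2∣ρ = n-odd (subst (2 ∣_) (sym n≡) (∣m⇒∣m*n A (∣-trans 2∣ρ ρ∣ρ^)))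
      where
      ρ∣ρ^ : ρ ∣ ρ ^ pred m
      ρ∣ρ^ = [ (λ { refl → m∣m*n _ }) , (λ { refl → m∣m*n _ }) ]′ m≡

    -- `exceptional-∣` is used with c = γ and l = β + 1, whose sum is α + 1.
    D≤ : ρ ^ pred m ≤ q ^ suc β + m * pred ρ
    D≤ = ∣⇒≤ {{m+n≢0ˡ}} (exceptional-∣ {q} {γ} {suc β} ρ m
      (subst (λ i → ρ ^ pred m ∣ pred (q ^ i)) (sym (trans (+-suc γ β) (cong suc γ+β≡α)))
        (∣-trans (ρ^∣geo N m-prime E) (geo-pred q (suc α)))) geo≡)
      where
      m+n≢0ˡ : NonZero (q ^ suc β + m * pred ρ)
      m+n≢0ˡ = >-nonZero (≤-trans (m^n>0 q (suc β)) (m≤m+n _ _))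

    -- If β < γ, then m q^(β+1) ≤ m q^γ = `geo ρ m`, and m times `D≤` contradicts
    -- `exceptional-bound`.
    γ≤β : γ ≤ β
    γ≤β = ≮⇒≥ λ β<γ → <⇒≱ (exceptional-bound m≡ ρ-prime ρ-odd p∣ρ-1)
      (+-cancelˡ-≤ (ρ ^ pred m) _ _ (begin
        ρ ^ pred m + pred m * ρ ^ pred m                   ≡⟨ cong (_* ρ ^ pred m) (suc-pred m) ⟩
        m * ρ ^ pred m                                     ≤⟨ *-monoʳ-≤ m D≤ ⟩
        m * (q ^ suc β + m * pred ρ)                       ≤⟨ *-monoʳ-≤ m (+-monoˡ-≤ (m * pred ρ) (^-monoʳ-≤ q β<γ)) ⟩
        m * (q ^ γ + m * pred ρ)                           ≡⟨ *-distribˡ-+ m (q ^ γ) (m * pred ρ) ⟩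
        m * q ^ γ + m * (m * pred ρ)                       ≡⟨ cong (_+ m * (m * pred ρ)) geo≡ ⟨
        geo ρ m + m * (m * pred ρ)                         ≡⟨ cong (λ i → geo ρ i + m * (m * pred ρ)) (suc-pred m) ⟨
        geo ρ (suc (pred m)) + m * (m * pred ρ)            ≡⟨ cong (_+ m * (m * pred ρ)) (geo-snoc ρ (pred m)) ⟩
        geo ρ (pred m) + ρ ^ pred m + m * (m * pred ρ)     ≡⟨ rotate (geo ρ (pred m)) (ρ ^ pred m) (m * (m * pred ρ)) ⟩
        ρ ^ pred m + (geo ρ (pred m) + m * (m * pred ρ))   ∎))
      where
      open ≤-Reasoning
      rotate : ∀ a b c → a + b + c ≡ b + (a + c)
      rotate = solve-∀

    m∣n : m ∣ n
    m∣n = [ (λ m∣2 → contradiction m∣2 m∤2) , id ]′ (euclidsLemma 2 n m-prime (divides (geo q (suc α)) (trans 2n≡ (*-comm m _))))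
      where
      m∤2 : m ∤ 2
      m∤2 = odd-prime∤2 m-prime m-odd

    -- If m = q = 5, then q | n. If m = 3 and q = 5, take 3ᵉ ∥ n with e ≥ 1: σ(3ᵉ) divides 3 · 5^α
    -- and is prime to 3, so it is a power of 5 greater than 1. Then 5 | σ(3ᵉ) makes the number of
    -- terms even, and the sum even as well.
    q≢5 : q ≢ 5
    q≢5 q≡5 = [ at-3 q≡5 , (λ m≡5 → q∤n (subst (_∣ n) (trans m≡5 (sym q≡5)) m∣n)) ]′ m≡
      where
      at-3 : q ≡ 5 → m ≡ 3 → ⊥
      at-3 refl refl with prime-split prime[3] n n>0
      ... | zero , k , n≡k , 3∤k = 3∤k (subst (3 ∣_) (trans n≡k (*-identityˡ k)) m∣n)
      ... | suc e , k , refl , 3∤k with ∣prime^ prime[5] α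
            (∣^*-cancel {n = 5 ^ α} prime[3] (∤geo prime[3] ∣-refl (suc e)) 1
              (subst (geo 3 (suc (suc e)) ∣_)
                (trans (sym (σ-prime-power-* prime[3] (suc e) 3∤k (n≢0⇒n>0 λ { refl → 3∤k (3 ∣0) }))) σn≡) (m∣m*n (σ k))))
      ...   | zero , _ , geo≡1 = contradiction (k<geo (s≤s z<s) (suc (suc e)) (s≤s z<s))
              (λ lt → <⇒≱ lt (subst (_≤ suc (suc e)) (sym geo≡1) z<s))
      ...   | suc b , _ , geo≡5^ = subst Odd (sym geo≡5^) (odd^ (from-no (2 ∣? 5)) (suc b))
              (even⇒geo-even (from-no (2 ∣? 3)) (suc (suc e))
              (5∣geo3⇒even (suc (suc e)) (subst (5 ∣_) (sym geo≡5^) (m∣m*n (5 ^ b)))))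

    main : ∃[ u ] u > 0 × suc α ≡ 2 * u → ⊥
    main (u , u>0 , 1+α≡) = <⇒≱ 50u²<13ᵘ (begin
      13 ^ u                                ≤⟨ ^-monoˡ-≤ u 13≤q ⟩
      q ^ u                                 ≤⟨ ^-monoʳ-≤ q u≤β ⟩
      q ^ β                                 ≤⟨ qᵝ≤2A N m-prime E ⟩
      2 * A                                 ≤⟨ *-monoʳ-≤ 2 (∣⇒≤ {{nz}} (cofactor∣ N m-prime E u (∣-reflexive 1+α≡))) ⟩
      2 * (m * u * (m * u))                 ≤⟨ *-monoʳ-≤ 2 (*-mono-≤ (*-monoˡ-≤ u m≤5) (*-monoˡ-≤ u m≤5)) ⟩
      2 * (5 * u * (5 * u))                 ≡⟨ collect u ⟩
      50 * (u * u)                          ∎)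
      where
      open ≤-Reasoning
      collect : ∀ u → 2 * (5 * u * (5 * u)) ≡ 50 * (u * u)
      collect = solve-∀
      instance
        u≢0 : NonZero u
        u≢0 = >-nonZero u>0
        mu≢0 : NonZero (m * u)
        mu≢0 = m*n≢0 m u
      nz : NonZero (m * u * (m * u))
      nz = m*n≢0 (m * u) (m * u)
      α≤2β : α ≤ 2 * β
      α≤2β = subst₂ _≤_ γ+β≡α (cong (λ y → β + y) (sym (+-identityʳ β))) (+-monoˡ-≤ β γ≤β)
      -- β < u would give 2 β + 2 ≤ 2 u = α + 1 ≤ 2 β + 1.
      u≤β : u ≤ β
      u≤β = ≮⇒≥ λ β<u → <⇒≱ (s≤s (s≤s α≤2β)) (subst₂ _≤_ (*-suc 2 β) (sym 1+α≡) (*-monoʳ-≤ 2 β<u))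
      geo-2u : geo q (suc α) ≡ geo q 2 * geo (q ^ 2) u
      geo-2u = trans (cong (geo q) 1+α≡) (geo-* q 2 u)
      13≤q : 13 ≤ q
      13≤q = ≮⇒≥ λ q<13 → [ q≢5 , (λ 4∣ → 4∤geo (subst (4 ∣_) (sym geo-2u) (∣m⇒∣m*n _ 4∣))) ]′ (small-primes q q-prime q-odd q<13)
      -- For even u both factors 1 + q and `geo (q ^ 2) u` would be even.
      u-odd : Odd u
      u-odd 2∣u = 4∤geo (subst (4 ∣_) (sym geo-2u)
        (*-pres-∣ (even⇒geo-even q-odd 2 ∣-refl) (even⇒geo-even (odd^ q-odd 2) u 2∣u)))
      50u²<13ᵘ : 50 * (u * u) < 13 ^ u
      50u²<13ᵘ = large u u-odd u≤β 1+α≡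
        where
        large : ∀ u → Odd u → u ≤ β → suc α ≡ 2 * u → 50 * (u * u) < 13 ^ u
        large 0 odd _ _ = contradiction (2 ∣0) odd
        -- u = 1 means α = 1, but α = γ + β is at least 2.
        large 1 _ 1≤β 2≡ = contradiction (+-mono-≤ (γ>0 N m-prime E) 1≤β)
          (<⇒≱ (s≤s (≤-reflexive (trans γ+β≡α (suc-injective 2≡)))))
        large 2 odd _ _ = contradiction ∣-refl odd
        large (suc (suc (suc k))) _ _ _ = 50[3+k]²<13^[3+k] k

-- The ratio 2.

geo-2 : ∀ x → geo x 2 ≡ suc x
geo-2 x = cong suc (trans (cong (λ y → x * suc y) (*-zeroʳ x)) (*-identityʳ x))

-- 2 qᶜ ≡ 1 modulo x, so removing a factor qᶜ from a power of q amounts to doubling.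
double-residue : ∀ x .{{_ : NonZero x}} l j → suc x ≡ 2 * q ^ c →
  q ^ (c + l) % x ≡ 2 ^ j % x → q ^ l % x ≡ 2 ^ suc j % x
double-residue {q} {c} x l j 1+x≡ eq = begin
  q ^ l % x                             ≡⟨ [m+kn]%n≡m%n (q ^ l) (q ^ l) x ⟨
  (q ^ l + q ^ l * x) % x               ≡⟨ cong (_% x) (*-suc (q ^ l) x) ⟨
  (q ^ l * suc x) % x                   ≡⟨ cong (λ y → (q ^ l * y) % x) 1+x≡ ⟩
  (q ^ l * (2 * q ^ c)) % x             ≡⟨ cong (_% x) (rearrange (q ^ l) (q ^ c)) ⟩
  (2 * (q ^ c * q ^ l)) % x             ≡⟨ cong (λ y → (2 * y) % x) (^-distribˡ-+-* q c l) ⟨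
  (2 * q ^ (c + l)) % x                 ≡⟨ %-distribˡ-* 2 (q ^ (c + l)) x ⟩
  ((2 % x) * (q ^ (c + l) % x)) % x     ≡⟨ cong (λ y → ((2 % x) * y) % x) eq ⟩
  ((2 % x) * (2 ^ j % x)) % x           ≡⟨ %-distribˡ-* 2 (2 ^ j) x ⟨
  (2 * 2 ^ j) % x                       ∎
  where
  open ≡-Reasoning
  rearrange : ∀ y z → y * (2 * z) ≡ 2 * (z * y)
  rearrange = solve-∀

-- If l ≤ c, then qˡ and 2ʲ would both be reduced modulo x, hence equal.
residue⇒< : ∀ x .{{_ : NonZero x}} l j → 1 < q → Odd q → suc x ≡ 2 * q ^ c → c > 0 → 2 ^ suc j < x →
  q ^ l % x ≡ 2 ^ suc j % x → c < l
residue⇒< {q} {c} x l j 1<q q-odd 1+x≡ c>0 2ʲ<x eq = ≰⇒> λ l≤c →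
  odd^ q-odd l (subst (2 ∣_) (trans (sym (m<n⇒m%n≡m 2ʲ<x)) (trans (sym eq) (m<n⇒m%n≡m (q^<x l≤c)))) (m∣m*n (2 ^ j)))
  where
  instance
    q≢0 : NonZero q
    q≢0 = >-nonZero (<-trans z<s 1<q)
  q^<x : l ≤ c → q ^ l < x
  q^<x l≤c = s≤s⁻¹ (begin-strict
    suc (q ^ l)         ≤⟨ s≤s (^-monoʳ-≤ q l≤c) ⟩
    1 + q ^ c           <⟨ +-monoˡ-< (q ^ c) (<-≤-trans 1<q (subst (_≤ q ^ c) (*-identityʳ q) (^-monoʳ-≤ q c>0))) ⟩
    q ^ c + q ^ c       ≡⟨ cong (λ y → q ^ c + y) (+-identityʳ (q ^ c)) ⟨
    2 * q ^ c           ≡⟨ 1+x≡ ⟨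
    suc x               ∎)
    where open ≤-Reasoning

-- c and b stand for γ and β. From 3 c ≤ b follows 3 (c + b + 1) ≤ 3 + 4 b, whence the scaling by 9.
-- The comparison starts at b = 3 for q ≥ 5 and at b = 6 for q = 3, where c ≥ 2.
even-exclusion : ∀ q c b → 3 ≤ q → q ≢ 4 → c > 0 → (q ≡ 3 → c ≢ 1) → 3 * c ≤ b →
  2 * (suc (c + b) * suc (c + b)) < q ^ b
even-exclusion q c b 3≤q q≢4 c>0 q≡3⇒c≢1 3c≤b = *-cancelˡ-< 9 _ _ (≤-<-trans scaled (large q b 3≤q q≢4 q≡3⇒6≤b 3≤b))
  where
  3≤b : 3 ≤ b
  3≤b = ≤-trans (*-monoʳ-≤ 3 c>0) 3c≤b
  q≡3⇒6≤b : q ≡ 3 → 6 ≤ b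
  q≡3⇒6≤b q≡3 = ≤-trans (*-monoʳ-≤ 3 (≤∧≢⇒< c>0 (≢-sym (q≡3⇒c≢1 q≡3)))) 3c≤b
  bound : 3 * suc (c + b) ≤ 3 + 4 * b
  bound = subst₂ _≤_ (distrib c b) (collect b) (+-monoʳ-≤ 3 (+-monoˡ-≤ (3 * b) 3c≤b))
    where
    distrib : ∀ c b → 3 + (3 * c + 3 * b) ≡ 3 * suc (c + b)
    distrib = solve-∀
    collect : ∀ b → 3 + (b + 3 * b) ≡ 3 + 4 * b
    collect = solve-∀
  scaled : 9 * (2 * (suc (c + b) * suc (c + b))) ≤ 2 * ((3 + 4 * b) * (3 + 4 * b))
  scaled = subst (_≤ 2 * ((3 + 4 * b) * (3 + 4 * b))) (square (suc (c + b))) (*-monoʳ-≤ 2 (*-mono-≤ bound bound))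
    where
    square : ∀ y → 2 * (3 * y * (3 * y)) ≡ 9 * (2 * (y * y))
    square = solve-∀
  large : ∀ q b → 3 ≤ q → q ≢ 4 → (q ≡ 3 → 6 ≤ b) → 3 ≤ b → 2 * ((3 + 4 * b) * (3 + 4 * b)) < 9 * q ^ b
  large 1 b (s≤s ()) _ _ _
  large 2 b (s≤s (s≤s ())) _ _ _
  large 3 b _ _ 6≤b _ with m≤n⇒∃[o]m+o≡n (6≤b refl)
  ... | k , refl = subst (λ y → 2 * (y * y) < 9 * 3 ^ (6 + k)) (shift k) (2[27+4k]²<9*3^[6+k] k)
    where
    shift : ∀ k → 27 + 4 * k ≡ 3 + 4 * (6 + k)
    shift = solve-∀
  large 4 b _ q≢4 _ _ = contradiction refl q≢4
  large q@(suc (suc (suc (suc (suc q′))))) b _ _ _ 3≤b with m≤n⇒∃[o]m+o≡n 3≤b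
  ... | k , refl = <-≤-trans (subst (λ y → 2 * (y * y) < 9 * 5 ^ (3 + k)) (shift k) (2[15+4k]²<9*5^[3+k] k))
                     (*-monoʳ-≤ 9 (^-monoˡ-≤ (3 + k) (m≤m+n 5 q′)))
    where
    shift : ∀ k → 15 + 4 * k ≡ 3 + 4 * (3 + k)
    shift = solve-∀

module _ {q α n} (N : Cofactor q α n 2) (E : ExceptionalPrime q 2 α n) where
  open Cofactor N
  open ExceptionalPrime E

  private
    instance
      q≢0 : NonZero q
      q≢0 = prime⇒nonZero q-prime
      ρ≢0 : NonZero ρ
      ρ≢0 = prime⇒nonZero ρ-prime

  1+ρ≡ : suc ρ ≡ 2 * q ^ γ
  1+ρ≡ = trans (sym (geo-2 ρ)) geo≡

  3≤q : 3 ≤ q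
  3≤q = odd-prime≥3 q-prime q-odd

  q≢4 : q ≢ 4
  q≢4 q≡4 = q-odd (subst (2 ∣_) (sym q≡4) (divides 2 refl))

  ρ∣geo : ρ ∣ geo q (suc α)
  ρ∣geo = subst (_∣ geo q (suc α)) (*-identityʳ ρ) (ρ^∣geo N prime[2] E)

  α-even : Odd (suc α)
  α-even 2∣ = n-odd (subst (2 ∣_) (sym (*-cancelˡ-≡ n _ 2 2n≡)) (even⇒geo-even q-odd (suc α) 2∣))

  -- Otherwise ρ = 2 · 3 - 1 = 5 divides `geo 3 (suc α)`, and α + 1 would be even.
  q≡3⇒γ≢1 : q ≡ 3 → γ ≢ 1
  q≡3⇒γ≢1 q≡3 γ≡1 = α-even (5∣geo3⇒even (suc α) (subst₂ (λ x y → x ∣ geo y (suc α)) ρ≡5 q≡3 ρ∣geo))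
    where
    ρ≡5 : ρ ≡ 5
    ρ≡5 = suc-injective (trans 1+ρ≡ (cong₂ (λ x y → 2 * x ^ y) q≡3 γ≡1))

  -- Ensures that 2, 4 and 8 are reduced modulo ρ, which leaves room for three doublings.
  8<ρ : 8 < ρ
  8<ρ = s≤s⁻¹ (subst (9 <_) (sym 1+ρ≡) (*-monoʳ-≤ 2 (bound q γ 3≤q q≢4 (γ>0 N prime[2] E) q≡3⇒γ≢1)))
    where
    bound : ∀ q c → 3 ≤ q → q ≢ 4 → c > 0 → (q ≡ 3 → c ≢ 1) → 4 < q ^ c
    bound 1 _ (s≤s ()) _ _ _
    bound 2 _ (s≤s (s≤s ())) _ _ _
    bound 3 1 _ _ _ c≢1 = contradiction refl (c≢1 refl)
    bound 3 c@(suc (suc _)) _ _ _ _ = <-≤-trans (m≤m+n 5 4) (^-monoʳ-≤ 3 {2} {c} (s≤s (s≤s z≤n)))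
    bound 4 _ _ q≢4 _ _ = contradiction refl q≢4
    bound q@(suc (suc (suc (suc (suc q′))))) (suc c) _ _ _ _ =
      ≤-trans (m≤m+n 5 q′) (m≤m*n q (q ^ c) {{m^n≢0 q c}})

  -- From q^(α+1) ≡ 1 modulo ρ, removing q^γ three times gives q^(β+1) ≡ 2, q^(β+1-γ) ≡ 4 and
  -- q^(β+1-2γ) ≡ 8. By `residue⇒<` each of these exponents exceeds γ, so 3 γ < β + 1.
  3γ≤β : 3 * γ ≤ β
  3γ≤β = steps (residue⇒< {q} {γ} ρ (suc β) 0 1<q q-odd 1+ρ≡ (γ>0 N prime[2] E) (<-trans (m≤m+n 3 5) 8<ρ) r₁)
    where
    1<q : 1 < q
    1<q = prime≥2 q-prime
    r₁ : q ^ suc β % ρ ≡ 2 % ρ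
    r₁ = double-residue {q} {γ} ρ (suc β) 0 1+ρ≡ (begin
      q ^ (γ + suc β) % ρ             ≡⟨ cong (λ i → q ^ i % ρ) (trans (+-suc γ β) (cong suc γ+β≡α)) ⟩
      q ^ suc α % ρ                   ≡⟨ cong (_% ρ) (suc-pred (q ^ suc α) {{m^n≢0 q (suc α)}}) ⟨
      (1 + pred (q ^ suc α)) % ρ      ≡⟨ %-remove-+ʳ 1 (∣-trans ρ∣geo (geo-pred q (suc α))) ⟩
      1 % ρ                           ∎)
      where open ≡-Reasoning
    descend : ∀ l j → 2 ^ suc j < ρ → q ^ l % ρ ≡ 2 ^ suc j % ρ → ∃[ l′ ] γ + l′ ≡ l × q ^ l′ % ρ ≡ 2 ^ suc (suc j) % ρ
    descend l j small r with m≤n⇒∃[o]m+o≡n (<⇒≤ (residue⇒< {q} {γ} ρ l j 1<q q-odd 1+ρ≡ (γ>0 N prime[2] E) small r))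
    ... | l′ , refl = l′ , refl , double-residue {q} {γ} ρ l′ (suc j) 1+ρ≡ r
    steps : γ < suc β → 3 * γ ≤ β
    steps _ with descend (suc β) 0 (<-trans (m≤m+n 3 5) 8<ρ) r₁
    ... | l₂ , eq₂ , r₂ with descend l₂ 1 (<-trans (m≤m+n 5 3) 8<ρ) r₂
    ...   | l₃ , refl , r₃ = s≤s⁻¹ (begin-strict
      3 * γ               ≡⟨ collect γ ⟩
      γ + (γ + γ)         <⟨ +-monoʳ-< γ (+-monoʳ-< γ (residue⇒< {q} {γ} ρ l₃ 2 1<q q-odd 1+ρ≡ (γ>0 N prime[2] E) 8<ρ r₃)) ⟩
      γ + (γ + l₃)        ≡⟨ eq₂ ⟩
      suc β               ∎)
      where
      open ≤-Reasoning
      collect : ∀ c → 3 * c ≡ c + (c + c)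
      collect = solve-∀

  -- As α + 1 is odd here, M is α + 1 itself; the odd A sheds the factor 4 of (2 M)².
  A≤ : A ≤ suc α * suc α
  A≤ = ∣⇒≤ (∣^*-cancel {d = A} prime[2] (cofactor-odd N prime[2] E) 2 (subst (A ∣_) (square (suc α)) (cofactor∣ N prime[2] E (suc α) (n∣m*n 2))))
    where
    square : ∀ y → 2 * y * (2 * y) ≡ 4 * (y * y)
    square = solve-∀

  even-prime-case : ⊥
  even-prime-case = <⇒≱ exclusion (begin
    q ^ β                                   ≤⟨ qᵝ≤2A N prime[2] E ⟩
    2 * A                                   ≤⟨ *-monoʳ-≤ 2 A≤ ⟩
    2 * (suc α * suc α)                     ≡⟨ cong (λ i → 2 * (suc i * suc i)) γ+β≡α ⟨
    2 * (suc (γ + β) * suc (γ + β))         ∎)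
    where
    open ≤-Reasoning
    exclusion = even-exclusion q γ β 3≤q q≢4 (γ>0 N prime[2] E) q≡3⇒γ≢1 3γ≤β

-- The integral ratio σ(n)/q^α and the final inequality.

no-small-cofactor : ∀ {q α n} m → m ≤ 5 → ¬ Cofactor q α n m
no-small-cofactor 0 _ N = m≢0 N refl
no-small-cofactor 1 _ N = m≢1 N refl
no-small-cofactor 2 _ N = even-prime-case N (exceptional-prime q-prime q-odd prime[2] (inj₁ refl) n>0 n-odd σn≡)
  where open Cofactor N
no-small-cofactor 3 _ N = odd-prime-case N (inj₁ refl)
no-small-cofactor 4 _ N = m≢4 N refl
no-small-cofactor 5 _ N = odd-prime-case N (inj₂ refl)
no-small-cofactor (suc (suc (suc (suc (suc (suc _)))))) (s≤s (s≤s (s≤s (s≤s (s≤s ()))))) _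

perfect⇒cofactor : ∀ {q α n} → Prime q → α ≥ 1 → Odd (n * q ^ α) → Perfect (n * q ^ α) → q ∤ n →
  ∃[ m ] Cofactor q α n m
perfect⇒cofactor {q} {α@(suc α′)} {n} q-prime _ N-odd (_ , σN≡) q∤n = ratio , record
  { q-prime = q-prime
  -- α ≥ 1 makes q a divisor of the odd number N.
  ; q-odd   = λ 2∣q → N-odd (∣n⇒∣m*n n (∣m⇒∣m*n (q ^ α′) 2∣q))
  ; q∤n     = q∤n
  ; n>0     = n>0
  ; n-odd   = N-odd ∘ ∣m⇒∣m*n (q ^ α)
  ; σn≡     = m∣n⇒n≡quotient*m qᵅ∣σn
  ; 2n≡     = *-cancelʳ-≡ _ _ (q ^ α) {{m^n≢0 q α {{prime⇒nonZero q-prime}}}} (begin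
      2 * n * q ^ α                     ≡⟨ *-assoc 2 n (q ^ α) ⟩
      2 * (n * q ^ α)                   ≡⟨ geo*σ≡ ⟨
      geo q (suc α) * σ n               ≡⟨ cong (geo q (suc α) *_) (m∣n⇒n≡quotient*m qᵅ∣σn) ⟩
      geo q (suc α) * (ratio * q ^ α)   ≡⟨ swap (geo q (suc α)) ratio (q ^ α) ⟩
      ratio * geo q (suc α) * q ^ α     ∎)
  }
  where
  open ≡-Reasoning
  n>0 : n > 0
  n>0 = n≢0⇒n>0 λ { refl → q∤n (q ∣0) }
  geo*σ≡ : geo q (suc α) * σ n ≡ 2 * (n * q ^ α)
  geo*σ≡ = trans (sym (σ-prime-power-* q-prime α q∤n n>0)) (trans (cong σ (*-comm (q ^ α) n)) σN≡)
  qᵅ∣σn : q ^ α ∣ σ n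
  qᵅ∣σn = ^∣*-cancel q-prime (∤geo q-prime ∣-refl α) α
    (subst (q ^ α ∣_) (sym geo*σ≡) (∣n⇒∣m*n 2 (n∣m*n n)))
  ratio = quotient qᵅ∣σn
  swap : ∀ g m y → g * (m * y) ≡ m * g * y
  swap = solve-∀

-- `ℚ./` reduces to lowest terms, so the comparison is made on the unreduced fraction n/d by cross
-- multiplication.
5/1<n/d : ∀ n d .{{_ : NonZero d}} → 5 * d < n → (+ n) ℚ./ d ℚ.> (+ 5) ℚ./ 1
5/1<n/d n d@(suc _) 5d<n = ℚ.toℚᵘ-cancel-< (ℚᵘ.<-respʳ-≃ (ℚᵘ.≃-sym (ℚ.toℚᵘ-fromℚᵘ (mkℚᵘ (+ n) (pred d))))
  (*<* (subst₂ ℤ._<_ (ℤ.pos-* 5 d) (sym (ℤ.*-identityʳ (+ n))) (+<+ 5d<n))))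

theorem1p1 : ∀ (N q α : ℕ) → Odd N → Perfect N → (q-prime : Prime q) → α ≥ 1 → q ^ α ∥ N →
    let instance
          q^α≢0 : NonZero (q ^ α)
          q^α≢0 = m^n≢0 q α {{prime⇒nonZero q-prime}}
    in (+ σ (N / q ^ α)) ℚ./ (q ^ α) ℚ.> (+ 5) ℚ./ 1
theorem1p1 N q α N-odd N-perfect q-prime α≥1 (divides n refl , q^1+α∤N) =
  5/1<n/d (σ (N / q ^ α)) (q ^ α) (subst (λ k → 5 * q ^ α < σ k) (sym (m*n/n≡m n (q ^ α)))
    (let m , C = perfect⇒cofactor q-prime α≥1 N-odd N-perfect q∤n
     in subst (5 * q ^ α <_) (sym (Cofactor.σn≡ C)) (*-monoˡ-< (q ^ α) (≰⇒> λ m≤5 → no-small-cofactor m m≤5 C))))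
  where
  instance
    q^α≢0 : NonZero (q ^ α)
    q^α≢0 = m^n≢0 q α {{prime⇒nonZero q-prime}}
  q∤n : q ∤ n
  q∤n q∣n = q^1+α∤N (*-monoˡ-∣ (q ^ α) q∣n)
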